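{- Let $k\ge1$ be a fixed integer and $t\ge1$ an integer. Let $G$ be a connected graph with $n$ vertices and $m$ edges having a (multiplicative) $t$-spanner with tree-width $k-1$. Then $G$ admits an additive $(2\lceil t/2\rceil(1+\log_2 n))$-spanner with at most $O(kn\log n)$ edges, constructible in polynomial time (for every fixed $k$).
   Context: Graphs are finite, connected, unweighted, undirected and simple; $d_G$ is the shortest-path distance. A spanning subgraph $H$ of $G$ is a (multiplicative) $t$-spanner if $d_H(u,v)\le t\cdot d_G(u,v)$ for all vertices $u,v$, and an additive $r$-spanner if $d_H(u,v)\le d_G(u,v)+r$ for all $u,v$. Tree-width is the usual Robertson–Seymour tree-width (minimum over tree-decompositions of the maximum bag size minus one). -}

module Defs where

open import Data.Bool.Base using (Bool; true; false; T)
open import Data.Bool.Properties using (T?)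
open import Data.Fin.Base using (Fin; zero; suc; inject₁; fromℕ)
import Data.Fin.Properties as Fin
open import Data.Fin.Subset using (Subset; _∈_; ∣_∣)
open import Data.List.Base using (List; []; _∷_; length; filter; allFin; cartesianProduct; tabulate)
open import Data.List.Extrema.Nat using (max)
open import Data.Nat.Base using (ℕ; zero; suc; _+_; _*_; _∸_; _^_; _≤_; NonZero)
open import Data.Product.Base using (∃-syntax; _×_; _,_)
open import Function.Definitions using (Injective)
open import Relation.Binary.Construct.Closure.ReflexiveTransitive using (Star)
open import Relation.Binary.PropositionalEquality.Core using (_≡_)
open import Relation.Nullary using (¬_)
open import Relation.Nullary.Decidable using (_×-dec_)

record Graph (n : ℕ) : Set where
  field
    adj    : Fin n → Fin n → Bool
    sym    : ∀ {u v} → T (adj u v) → T (adj v u)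
    irrefl : ∀ {v} → ¬ T (adj v v)

open Graph public using (adj)

Adj : ∀ {n} → Graph n → Fin n → Fin n → Set
Adj G u v = T (adj G u v)

edgeCount : ∀ {n} → Graph n → ℕ
edgeCount {n} G =
  length (filter (λ (u , v) → (u Fin.<? v) ×-dec T? (adj G u v))
                 (cartesianProduct (allFin n) (allFin n)))

_⊆ᴳ_ : ∀ {n} → Graph n → Graph n → Set
H ⊆ᴳ G = ∀ u v → Adj H u v → Adj G u v

data Walk {n} (G : Graph n) : Fin n → Fin n → ℕ → Set where
  []  : ∀ {v} → Walk G v v 0
  _∷_ : ∀ {u v w ℓ} → Adj G u v → Walk G v w ℓ → Walk G u w (suc ℓ)

-- Vertices in different components are related to no d.
IsDistance : ∀ {n} → Graph n → Fin n → Fin n → ℕ → Set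
IsDistance G u v d = Walk G u v d × (∀ ℓ → Walk G u v ℓ → d ≤ ℓ)

record Connected {n} (G : Graph n) : Set where
  field
    nonEmpty : NonZero n
    joined   : ∀ u v → ∃[ ℓ ] Walk G u v ℓ

record Cycle {n} (G : Graph n) : Set where
  field
    extra    : ℕ
    vertex   : Fin (3 + extra) → Fin n
    distinct : Injective _≡_ _≡_ vertex
    step     : ∀ i → Adj G (vertex (inject₁ i)) (vertex (suc i))
    close    : Adj G (vertex (fromℕ (2 + extra))) (vertex zero)

record IsTree {n} (G : Graph n) : Set where
  field
    connected : Connected G
    acyclic   : ¬ Cycle G

record TreeDecomposition {n} (G : Graph n) : Set where
  field
    {size} : ℕ
    tree   : Graph size
    isTree : IsTree tree
    bag    : Fin size → Subset n

    coversVertices : ∀ v → ∃[ i ] v ∈ bag i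
    coversEdges    : ∀ u v → Adj G u v → ∃[ i ] (u ∈ bag i × v ∈ bag i)
    -- the nodes whose bags contain v induce a connected subgraph of the tree
    coherent       : ∀ v i j → v ∈ bag i → v ∈ bag j →
                     Star (λ x y → Adj tree x y × v ∈ bag x × v ∈ bag y) i j

  width : ℕ
  width = max 0 (tabulate (λ i → ∣ bag i ∣)) ∸ 1

open TreeDecomposition public using (width)

record HasTreeWidth {n} (G : Graph n) (w : ℕ) : Set where
  field
    decomposition : TreeDecomposition G
    attained      : width decomposition ≡ w
    minimal       : ∀ (D : TreeDecomposition G) → w ≤ width D

-- The real number a + b · log₂ n.
record LogBound : Set where
  constructor _+_·log₂_
  field
    constant coefficient argument : ℕ

-- x ≤ y + (a + b · log₂ n), exponentiated so that it speaks of naturals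
-- only; for n ≥ 1 the two inequalities are equivalent.
_≤_⊕_ : ℕ → ℕ → LogBound → Set
x ≤ y ⊕ (a + b ·log₂ n) = 2 ^ x ≤ 2 ^ (y + a) * n ^ b

record IsSpanner {n} (t : ℕ) (H G : Graph n) : Set where
  field
    subgraph : H ⊆ᴳ G
    stretch  : ∀ u v d → IsDistance G u v d →
               ∃[ d′ ] (IsDistance H u v d′ × d′ ≤ t * d)

record IsAdditiveSpanner {n} (r : LogBound) (H G : Graph n) : Set where
  field
    subgraph : H ⊆ᴳ G
    stretch  : ∀ u v d → IsDistance G u v d →
               ∃[ d′ ] (IsDistance H u v d′ × d′ ≤ d ⊕ r)

-- While programs over binary trees, in the style of Jones'
-- language WHILE.  Every operation takes one unit of time.  Trees are
-- immutable and can be shared, so each operation is a constant number of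
-- pointer manipulations; running time polynomial in this model is running
-- time polynomial on a Turing machine, and conversely.
data Data : Set where
  nil : Data
  _∙_ : Data → Data → Data

head tail : Data → Data
head nil     = nil
head (x ∙ _) = x
tail nil     = nil
tail (_ ∙ y) = y

data Program : Set where
  skip mknil hd tl   : Program
  cons               : Program → Program → Program
  _⨾_                : Program → Program → Program
  if_then_else_      : Program → Program → Program → Program
  while_loop_        : Program → Program → Program

-- p ⊢ x ⇓ y [ c ]: on input x, p halts with output y after c steps.
-- As a condition, nil is false and every other tree is true.
data _⊢_⇓_[_] : Program → Data → Data → ℕ → Set where
  skip  : ∀ {x} → skip  ⊢ x ⇓ x      [ 1 ]
  mknil : ∀ {x} → mknil ⊢ x ⇓ nil    [ 1 ]
  hd    : ∀ {x} → hd    ⊢ x ⇓ head x [ 1 ]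
  tl    : ∀ {x} → tl    ⊢ x ⇓ tail x [ 1 ]
  cons  : ∀ {p q x y z b c} →
          p ⊢ x ⇓ y [ b ] → q ⊢ x ⇓ z [ c ] →
          cons p q ⊢ x ⇓ (y ∙ z) [ suc (b + c) ]
  seq   : ∀ {p q x y z b c} →
          p ⊢ x ⇓ y [ b ] → q ⊢ y ⇓ z [ c ] →
          (p ⨾ q) ⊢ x ⇓ z [ suc (b + c) ]
  then′ : ∀ {e p q x u v y b c} →
          e ⊢ x ⇓ (u ∙ v) [ b ] → p ⊢ x ⇓ y [ c ] →
          (if e then p else q) ⊢ x ⇓ y [ suc (b + c) ]
  else′ : ∀ {e p q x y b c} →
          e ⊢ x ⇓ nil [ b ] → q ⊢ x ⇓ y [ c ] →
          (if e then p else q) ⊢ x ⇓ y [ suc (b + c) ]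
  stop  : ∀ {e p x b} →
          e ⊢ x ⇓ nil [ b ] →
          (while e loop p) ⊢ x ⇓ x [ suc b ]
  loop  : ∀ {e p x u v y z b c d} →
          e ⊢ x ⇓ (u ∙ v) [ b ] → p ⊢ x ⇓ y [ c ] →
          (while e loop p) ⊢ y ⇓ z [ d ] →
          (while e loop p) ⊢ x ⇓ z [ suc (b + c + d) ]

encodeBool : Bool → Data
encodeBool false = nil
encodeBool true  = nil ∙ nil

encodeList : List Data → Data
encodeList []       = nil
encodeList (x ∷ xs) = x ∙ encodeList xs

encode : ∀ {n} → Graph n → Data
encode G = encodeList (tabulate λ u → encodeList (tabulate λ v → encodeBool (adj G u v)))

{-# OPTIONS --safe #-}
module Submission where

-- Put ρ = ⌈t/2⌉.  An S-path of length at most t between adjacent vertices of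
-- G passes a vertex of a bag only if one of its ends is within ρ of that
-- vertex.  So deleting from a vertex set A the balls of radius ρ in G around
-- the vertices of a bag respects the tree decomposition of S, and for some bag
-- it leaves components of at most |A|/2 vertices.  The algorithm takes, for
-- each component A of the remaining graph, the least radius r for which k
-- balls do so (hence r ≤ ρ, without knowing t), deletes these balls, and
-- repeats; nothing remains after 1 + log₂ n levels.  For each centre c it adds
-- two breadth-first forests of G[A]: one grown from the ball around c, one
-- from c itself.  That is at most 2k links per vertex and level.
--
-- A walk whose first deletion happens at level ℓ has surplus 2ρ(ℓ + 1):
-- follow the forest from both ends into the ball that is hit, and go from
-- there to there through the centre c.  If this walk of length at most 2ρ
-- stays inside A, the tree grown from c contains a replacement; if not, it
-- meets an earlier separator, and induction on ℓ applies.
--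
-- The program is compiled from a functional language whose only loops range
-- over the vertices, so its running time is polynomial whatever it computes.

open import Data.Bool.Base using (Bool; true; false; T) renaming (if_then_else_ to ifᵇ_then_else_)
open import Data.Bool.Properties using (T?)
open import Data.Empty using (⊥; ⊥-elim)
open import Data.Fin.Base using (Fin; zero; suc; toℕ; fromℕ; inject₁)
import Data.Fin.Properties as Fin
open import Data.Fin.Subset using (Subset; ∣_∣) renaming (_∈_ to _∈ᵇ_)
open import Data.List.Base using (List; []; _∷_)
import Data.List.Base as List
open import Data.List.Extrema.Nat using (max; xs≤max)
import Data.List.Properties as List
import Data.List.Relation.Unary.All.Properties as All
open import Data.Nat.Base
open import Data.Nat.Properties
open import Data.Nat.Solver using (module +-*-Solver)
open import Data.Product.Base using (Σ-syntax; ∃-syntax; _×_; _,_; proj₁; proj₂)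
open import Data.Sum.Base using (_⊎_; inj₁; inj₂; [_,_]′)
open import Data.Vec.Base using (Vec; []; _∷_; here; there; lookup; tabulate; replicate)
open import Data.Vec.Properties using (lookup∘tabulate; tabulate∘lookup; tabulate-cong)
open import Function.Base using (_∘_; id)
open import Function.Bundles using (_⇔_; mk⇔; Equivalence)
open import Relation.Binary.Construct.Closure.ReflexiveTransitive using (Star; ε; _◅_; _◅◅_)
import Relation.Binary.Construct.Closure.ReflexiveTransitive as Star
open import Relation.Binary.Definitions using (tri<; tri≈; tri>)
open import Relation.Binary.PropositionalEquality
open import Relation.Nullary
open import Relation.Nullary.Decidable using (map′; _×-dec_; ¬?; decidable-stable)
import Relation.Unary as U
open import Algebra.Properties.CommutativeMonoid.Sum +-0-commutativeMonoid
  using (sum; ∑-comm; ∑-distrib-+; sum-cong-≗)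
open import Defs hiding (head; tail)
open import Defs using () renaming (head to hdᴰ; tail to tlᴰ)

open Equivalence using (to; from)

-- A language of polynomial-time functions

infixr 6 _⊗_
-- Values of `idx` are below `n`, so a loop that counts one down makes at most `n` rounds. Values of
-- `num` have no such bound and are only changed or tested by the constant-time `suc′`, `pred′` and
-- `isz`.
data Ty : Set where
  bool idx num : Ty
  tab          : Ty → Ty
  _⊗_          : Ty → Ty → Ty

Val : ℕ → Ty → Set
Val n bool    = Bool
Val n idx     = Fin n
Val n num     = ℕ
Val n (tab τ) = Vec (Val n τ) n
Val n (σ ⊗ τ) = Val n σ × Val n τ

Ctx : Set
Ctx = List Ty

infix 4 _∋_
data _∋_ : Ctx → Ty → Set where
  here  : ∀ {Γ τ} → τ ∷ Γ ∋ τ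
  there : ∀ {Γ σ τ} → Γ ∋ τ → σ ∷ Γ ∋ τ

infixr 5 _∷_
data Env (n : ℕ) : Ctx → Set where
  []  : Env n []
  _∷_ : ∀ {Γ τ} → Val n τ → Env n Γ → Env n (τ ∷ Γ)

fetch : ∀ {n Γ τ} → Γ ∋ τ → Env n Γ → Val n τ
fetch here      (v ∷ ρ) = v
fetch (there x) (v ∷ ρ) = fetch x ρ

-- The highest index acts first and `zero` last, the order in which a unary counter runs down.
repeat : ∀ {A : Set} m → (Fin m → A → A) → A → A
repeat zero    f s = s
repeat (suc m) f s = f zero (repeat m (f ∘ suc) s)

mutual
  data Term (Γ : Ctx) : Ty → Set where
    var         : ∀ {τ} → Γ ∋ τ → Term Γ τ
    ff tt       : Term Γ bool
    ite         : ∀ {τ} → Term Γ bool → Term Γ τ → Term Γ τ → Term Γ τ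
    leq         : Term Γ idx → Term Γ idx → Term Γ bool
    zer         : Term Γ num
    suc′ pred′  : Term Γ num → Term Γ num
    isz         : Term Γ num → Term Γ bool
    pair        : ∀ {σ τ} → Term Γ σ → Term Γ τ → Term Γ (σ ⊗ τ)
    fst         : ∀ {σ τ} → Term Γ (σ ⊗ τ) → Term Γ σ
    snd         : ∀ {σ τ} → Term Γ (σ ⊗ τ) → Term Γ τ
    get         : ∀ {τ} → Term Γ (tab τ) → Term Γ idx → Term Γ τ
    table       : ∀ {τ} → Term (idx ∷ Γ) τ → Term Γ (tab τ)
    fold        : ∀ {τ} → Term Γ τ → Term (τ ∷ idx ∷ Γ) τ → Term Γ τ
    call        : ∀ {Δ τ} → Term Δ τ → Args Γ Δ → Term Γ τ

  data Args (Γ : Ctx) : Ctx → Set where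
    []  : Args Γ []
    _∷_ : ∀ {Δ τ} → Term Γ τ → Args Γ Δ → Args Γ (τ ∷ Δ)

isZero : ℕ → Bool
isZero zero    = true
isZero (suc _) = false

mutual
  eval : ∀ {n Γ τ} → Term Γ τ → Env n Γ → Val n τ
  eval (var x)     ρ = fetch x ρ
  eval ff          ρ = false
  eval tt          ρ = true
  eval (ite b t e) ρ = ifᵇ eval b ρ then eval t ρ else eval e ρ
  eval (leq i j)   ρ = isZero (toℕ (eval i ρ) ∸ toℕ (eval j ρ))
  eval zer         ρ = 0
  eval (suc′ m)    ρ = suc (eval m ρ)
  eval (pred′ m)   ρ = pred (eval m ρ)
  eval (isz m)     ρ = isZero (eval m ρ)
  eval (pair s t)  ρ = eval s ρ , eval t ρ
  eval (fst t)     ρ = proj₁ (eval t ρ)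
  eval (snd t)     ρ = proj₂ (eval t ρ)
  eval (get t i)   ρ = lookup (eval t ρ) (eval i ρ)
  eval (table t)   ρ = tabulate λ i → eval t (i ∷ ρ)
  eval {n} (fold s t) ρ = repeat n (λ i v → eval t (v ∷ i ∷ ρ)) (eval s ρ)
  eval (call f ts) ρ = eval f (evals ts ρ)

  evals : ∀ {n Γ Δ} → Args Γ Δ → Env n Γ → Env n Δ
  evals []       ρ = []
  evals (t ∷ ts) ρ = eval t ρ ∷ evals ts ρ

-- Tree encodings and polynomial cost bounds

unary : ℕ → Data
unary zero    = nil
unary (suc m) = nil ∙ unary m

mutual
  enc : ∀ {n} τ → Val n τ → Data
  enc bool    b       = encodeBool b
  enc idx     i       = unary (toℕ i)
  enc num     m       = unary m
  enc (tab τ) v       = encVec τ v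
  enc (σ ⊗ τ) (v , w) = enc σ v ∙ enc τ w

  encVec : ∀ {n m} τ → Vec (Val n τ) m → Data
  encVec τ []      = nil
  encVec τ (v ∷ w) = enc τ v ∙ encVec τ w

encEnv : ∀ {n Γ} → Env n Γ → Data
encEnv []              = nil
encEnv (_∷_ {τ = τ} v ρ) = enc τ v ∙ encEnv ρ

infixl 6 _⊞_
-- Polynomials in `n` are kept as syntax, so that the cost of a program can be inferred from the way
-- its run is put together.
data Cost : Set where
  fixed : ℕ → Cost
  _⊞_  : Cost → Cost → Cost
  N·_  : Cost → Cost

at : Cost → ℕ → ℕ
at (fixed c)   n = c
at (b ⊞ c) n = at b n + at c n
at (N· b)  n = n * at b n

at-polynomial : ∀ b → Σ[ a ∈ ℕ ] Σ[ e ∈ ℕ ] (∀ n → 1 ≤ n → at b n ≤ a * n ^ e)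
at-polynomial (fixed c) = c , 0 , λ n _ → ≤-reflexive (sym (*-identityʳ c))
at-polynomial (b ⊞ c) with at-polynomial b | at-polynomial c
... | a , e , p | a′ , e′ , p′ = a + a′ , e + e′ , λ { n@(suc _) 1≤n → begin
    at b n + at c n                        ≤⟨ +-mono-≤ (p n 1≤n) (p′ n 1≤n) ⟩
    a * n ^ e + a′ * n ^ e′                ≤⟨ +-mono-≤ (*-monoʳ-≤ a (^-monoʳ-≤ n (m≤m+n e e′)))
        (*-monoʳ-≤ a′ (^-monoʳ-≤ n (m≤n+m e′ e))) ⟩
    a * n ^ (e + e′) + a′ * n ^ (e + e′)   ≡⟨ *-distribʳ-+ (n ^ (e + e′)) a a′ ⟨
    (a + a′) * n ^ (e + e′)                ∎ }
  where open ≤-Reasoning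
at-polynomial (N· b) with at-polynomial b
... | a , e , p = a , suc e , λ n 1≤n → begin
    n * at b n         ≤⟨ *-monoʳ-≤ n (p n 1≤n) ⟩
    n * (a * n ^ e)    ≡⟨ *-assoc n a (n ^ e) ⟨
    n * a * n ^ e      ≡⟨ cong (_* n ^ e) (*-comm n a) ⟩
    a * n * n ^ e      ≡⟨ *-assoc a n (n ^ e) ⟩
    a * (n * n ^ e)    ∎
  where open ≤-Reasoning

record Run (n : ℕ) (p : Program) (x y : Data) (b : Cost) : Set where
  constructor ran
  field
    {steps} : ℕ
    halts   : p ⊢ x ⇓ y [ steps ]
    bounded : steps ≤ at b n

module _ {n : ℕ} where
  skipᴿ : ∀ {x} → Run n skip x x (fixed 1)
  skipᴿ = ran skip ≤-refl

  nilᴿ : ∀ {x} → Run n mknil x nil (fixed 1)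
  nilᴿ = ran mknil ≤-refl

  hdᴿ : ∀ {x} → Run n hd x (hdᴰ x) (fixed 1)
  hdᴿ = ran hd ≤-refl

  tlᴿ : ∀ {x} → Run n tl x (tlᴰ x) (fixed 1)
  tlᴿ = ran tl ≤-refl

  consᴿ : ∀ {p q x y z b c} → Run n p x y b → Run n q x z c → Run n (cons p q) x (y ∙ z) (fixed 1 ⊞ (b ⊞ c))
  consᴿ (ran r l) (ran s m) = ran (cons r s) (s≤s (+-mono-≤ l m))

  infixr 5 _⨾ᴿ_
  _⨾ᴿ_ : ∀ {p q x y z b c} → Run n p x y b → Run n q y z c → Run n (p ⨾ q) x z (fixed 1 ⊞ (b ⊞ c))
  (ran r l) ⨾ᴿ (ran s m) = ran (seq r s) (s≤s (+-mono-≤ l m))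

  -- Both branches are charged, which makes the bound independent of the value tested.
  ifᴿ : ∀ {e p q x y z a b c} β → Run n e x (encodeBool β) a →
        Run n p x y b → Run n q x z c →
        Run n (if e then p else q) x (ifᵇ β then y else z) (fixed 1 ⊞ (a ⊞ (b ⊞ c)))
  ifᴿ {b = b} true (ran r l) (ran s m) _ =
    ran (then′ r s) (s≤s (+-mono-≤ l (≤-trans m (m≤m+n (at b n) _))))
  ifᴿ {c = c} false (ran r l) _ (ran s m) =
    ran (else′ r s) (s≤s (+-mono-≤ l (≤-trans m (m≤n+m (at c n) _))))

repeat-last : ∀ {A : Set} m (f : Fin (suc m) → A → A) s →
              repeat (suc m) f s ≡ repeat m (f ∘ inject₁) (f (fromℕ m) s)
repeat-last zero    f s = refl
repeat-last (suc m) f s = cong (f zero) (repeat-last m (f ∘ suc) s)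

-- A loop on (m ∙ accumulator ∙ environment) that counts m down to 0.
countdown : Program → Program
countdown q = while hd loop cons (hd ⨾ tl) (cons q (tl ⨾ tl))

-- The body sees the counter before it is decremented, hence `suc (toℕ i)`. Each round pays 10 steps
-- for test and bookkeeping, and the final test costs 2.
countdownᴿ : ∀ {n A q e b} (encode : A → Data) m (f : Fin m → A → A) s → m ≤ n →
             (∀ i s → Run n q (unary (suc (toℕ i)) ∙ (encode s ∙ e)) (encode (f i s)) b) →
             Run n (countdown q) (unary m ∙ (encode s ∙ e)) (nil ∙ (encode (repeat m f s) ∙ e))
                 (fixed 2 ⊞ N· (b ⊞ fixed 10))
countdownᴿ {n} {A} {q} {e} {b} encode m f s m≤n body with go m f s body
  where
  go : ∀ m (f : Fin m → A → A) s →
       (∀ i s → Run n q (unary (suc (toℕ i)) ∙ (encode s ∙ e)) (encode (f i s)) b) →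
       ∃[ c ] (countdown q ⊢ unary m ∙ (encode s ∙ e) ⇓ nil ∙ (encode (repeat m f s) ∙ e) [ c ] ×
               c ≤ 2 + m * (at b n + 10))
  go zero    f s body = _ , stop hd , ≤-refl
  go (suc m) f s body
    with body (fromℕ m) s | go m (f ∘ inject₁) (f (fromℕ m) s)
           (λ i s → subst (λ j → Run n q (unary (suc j) ∙ (encode s ∙ e)) (encode (f (inject₁ i) s)) b)
                          (Fin.toℕ-inject₁ i) (body (inject₁ i) s))
  ... | ran {c} r c≤ | c′ , r′ , c′≤ rewrite Fin.toℕ-fromℕ m | repeat-last m f s =
    _ , loop hd (cons (seq hd tl) (cons r (seq tl tl))) r′ , (begin
      suc (1 + suc (3 + suc (c + 3)) + c′)
          ≡⟨ cong (λ z → suc (suc (suc (3 + suc z + c′)))) (+-comm c 3) ⟩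
      10 + (c + c′)                                   ≤⟨ +-monoʳ-≤ 10 (+-mono-≤ c≤ c′≤) ⟩
      10 + (at b n + (2 + m * (at b n + 10)))         ≡⟨ +-assoc 10 (at b n) _ ⟨
      10 + at b n + (2 + m * (at b n + 10))
          ≡⟨ cong (_+ (2 + m * (at b n + 10))) (+-comm 10 (at b n)) ⟩
      at b n + 10 + (2 + m * (at b n + 10))           ≡⟨ +-assoc (at b n + 10) 2 _ ⟨
      at b n + 10 + 2 + m * (at b n + 10)
          ≡⟨ cong (_+ m * (at b n + 10)) (+-comm (at b n + 10) 2) ⟩
      2 + (at b n + 10) + m * (at b n + 10)           ≡⟨ +-assoc 2 (at b n + 10) _ ⟩
      2 + suc m * (at b n + 10)                       ∎)
    where open ≤-Reasoning
... | c , r , c≤ = ran r (≤-trans c≤ (+-monoʳ-≤ 2 (*-monoˡ-≤ _ m≤n)))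

drop : ℕ → Data → Data
drop zero    x = x
drop (suc m) x = drop m (tlᴰ x)

-- One loop serves both `get`, where it moves along an encoded table, and `leq`, where it is
-- truncated subtraction of unary numerals.
dropLoop : Program
dropLoop = while hd loop cons (hd ⨾ tl) (tl ⨾ tl)

dropᴿ : ∀ {n} m x → m ≤ n → Run n dropLoop (unary m ∙ x) (nil ∙ drop m x) (fixed 2 ⊞ N· (fixed 9))
dropᴿ {n} m x m≤n with go m x
  where
  go : ∀ m x → ∃[ c ] (dropLoop ⊢ unary m ∙ x ⇓ nil ∙ drop m x [ c ] × c ≤ 2 + m * 9)
  go zero    x = _ , stop hd , ≤-refl
  go (suc m) x with go m (tlᴰ x)
  ... | c , r , c≤ = _ , loop hd (cons (seq hd tl) (seq tl tl)) r , +-monoʳ-≤ 9 c≤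
... | c , r , c≤ = ran r (≤-trans c≤ (+-monoʳ-≤ 2 (*-monoˡ-≤ 9 m≤n)))

enc-if : ∀ {n} τ b {v w : Val n τ} → (ifᵇ b then enc τ v else enc τ w) ≡ enc τ (ifᵇ b then v else w)
enc-if τ true  = refl
enc-if τ false = refl

drop-unary : ∀ j m → drop j (unary m) ≡ unary (m ∸ j)
drop-unary zero    m       = refl
drop-unary (suc j) zero    = trans (drop-unary j zero) (cong unary (0∸n≡0 j))
drop-unary (suc j) (suc m) = drop-unary j m

tail-unary : ∀ m → tlᴰ (unary m) ≡ unary (pred m)
tail-unary zero    = refl
tail-unary (suc m) = refl

head-drop-encVec : ∀ {n m} τ (v : Vec (Val n τ) m) i → hdᴰ (drop (toℕ i) (encVec τ v)) ≡ enc τ (lookup v i)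
head-drop-encVec τ (v ∷ w) zero    = refl
head-drop-encVec τ (v ∷ w) (suc i) = head-drop-encVec τ w i

encVec-tabulate : ∀ {n m} τ (f : Fin m → Val n τ) →
                  encodeList (repeat m (λ i l → enc τ (f i) ∷ l) []) ≡ encVec τ (tabulate f)
encVec-tabulate {m = zero}  τ f = refl
encVec-tabulate {m = suc m} τ f = cong (enc τ (f zero) ∙_) (encVec-tabulate τ (f ∘ suc))

isZeroᴿ : ∀ {n e x m a} → Run n e x (unary m) a →
          Run n (if e then mknil else cons mknil mknil) x (encodeBool (isZero m))
              (fixed 1 ⊞ (a ⊞ (fixed 1 ⊞ (fixed 1 ⊞ (fixed 1 ⊞ fixed 1)))))
isZeroᴿ {m = zero}  r = ifᴿ false r nilᴿ (consᴿ nilᴿ nilᴿ)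
isZeroᴿ {m = suc m} (ran r l) = ran (then′ r mknil) (s≤s (+-mono-≤ l (s≤s z≤n)))

substᴿ : ∀ {n p x y z b} → y ≡ z → Run n p x y b → Run n p x z b
substᴿ refl r = r

-- Compilation of terms to programs

mutual
  -- Program and cost are left to unification, which reads them off the `Run` combinators. The cost
  -- depends on the term alone: trees are shared, so no operation pays for the size of a value, and
  -- every loop makes at most `n` rounds. The input carries `n` in front of the environment, as the
  -- counter for `table` and `fold`.
  compile : ∀ {Γ τ} (t : Term Γ τ) → Σ[ p ∈ Program ] Σ[ b ∈ Cost ]
            (∀ {n} (ρ : Env n Γ) → Run n p (unary n ∙ encEnv ρ) (enc τ (eval t ρ)) b)
  compile (var x) = _ , _ , λ ρ → tlᴿ ⨾ᴿ proj₂ (proj₂ (compileVar x)) ρ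
  compile ff = _ , _ , λ ρ → nilᴿ
  compile tt = _ , _ , λ ρ → consᴿ nilᴿ nilᴿ
  compile (ite {τ} b s t) = _ , _ , λ ρ →
    substᴿ (enc-if τ (eval b ρ)) (ifᴿ (eval b ρ) (run b ρ) (run s ρ) (run t ρ))
  compile (leq i j) = _ , _ , λ ρ → isZeroᴿ (substᴿ (drop-unary (toℕ (eval j ρ)) (toℕ (eval i ρ)))
    (consᴿ (run j ρ) (run i ρ) ⨾ᴿ dropᴿ (toℕ (eval j ρ)) _ (Fin.toℕ≤n (eval j ρ)) ⨾ᴿ tlᴿ))
  compile zer = _ , _ , λ ρ → nilᴿ
  compile (suc′ m) = _ , _ , λ ρ → consᴿ nilᴿ (run m ρ)
  compile (pred′ m) = _ , _ , λ ρ → substᴿ (tail-unary (eval m ρ)) (run m ρ ⨾ᴿ tlᴿ)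
  compile (isz m) = _ , _ , λ ρ → isZeroᴿ (run m ρ)
  compile (pair s t) = _ , _ , λ ρ → consᴿ (run s ρ) (run t ρ)
  compile (fst t) = _ , _ , λ ρ → run t ρ ⨾ᴿ hdᴿ
  compile (snd t) = _ , _ , λ ρ → run t ρ ⨾ᴿ tlᴿ
  compile (get {τ} t i) = _ , _ , λ ρ → substᴿ (head-drop-encVec τ (eval t ρ) (eval i ρ))
    (consᴿ (run i ρ) (run t ρ) ⨾ᴿ dropᴿ (toℕ (eval i ρ)) _ (Fin.toℕ≤n (eval i ρ)) ⨾ᴿ (tlᴿ ⨾ᴿ hdᴿ))
  compile (table {τ} t) = _ , _ , λ {n} ρ → substᴿ (encVec-tabulate τ (λ i → eval t (i ∷ ρ)))
    -- The whole input is kept behind counter and accumulator, so that every round can rebuild the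
    -- body's environment from it.
    (consᴿ hdᴿ (consᴿ nilᴿ skipᴿ) ⨾ᴿ
     countdownᴿ encodeList n (λ i l → enc τ (eval t (i ∷ ρ)) ∷ l) [] ≤-refl
       (λ i l → consᴿ (consᴿ (tlᴿ ⨾ᴿ tlᴿ ⨾ᴿ hdᴿ) (consᴿ (hdᴿ ⨾ᴿ tlᴿ) (tlᴿ ⨾ᴿ tlᴿ ⨾ᴿ tlᴿ)) ⨾ᴿ run t (i ∷ ρ))
                      (tlᴿ ⨾ᴿ hdᴿ)) ⨾ᴿ
     (tlᴿ ⨾ᴿ hdᴿ))
  compile (fold {τ} s t) = _ , _ , λ {n} ρ →
    consᴿ hdᴿ (consᴿ (run s ρ) skipᴿ) ⨾ᴿ
    countdownᴿ (enc τ) n (λ i v → eval t (v ∷ i ∷ ρ)) (eval s ρ) ≤-refl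
      (λ i v → consᴿ (tlᴿ ⨾ᴿ tlᴿ ⨾ᴿ hdᴿ)
                     (consᴿ (tlᴿ ⨾ᴿ hdᴿ) (consᴿ (hdᴿ ⨾ᴿ tlᴿ) (tlᴿ ⨾ᴿ tlᴿ ⨾ᴿ tlᴿ)))
               ⨾ᴿ run t (v ∷ i ∷ ρ)) ⨾ᴿ
    (tlᴿ ⨾ᴿ hdᴿ)
  compile (call f ts) = _ , _ , λ ρ → consᴿ hdᴿ (proj₂ (proj₂ (compileArgs ts)) ρ) ⨾ᴿ run f (evals ts ρ)

  compileVar : ∀ {Γ τ} (x : Γ ∋ τ) → Σ[ p ∈ Program ] Σ[ b ∈ Cost ]
               (∀ {n} (ρ : Env n Γ) → Run n p (encEnv ρ) (enc τ (fetch x ρ)) b)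
  compileVar here      = _ , _ , λ { (v ∷ ρ) → hdᴿ }
  compileVar (there x) = _ , _ , λ { (v ∷ ρ) → tlᴿ ⨾ᴿ proj₂ (proj₂ (compileVar x)) ρ }

  compileArgs : ∀ {Γ Δ} (ts : Args Γ Δ) → Σ[ p ∈ Program ] Σ[ b ∈ Cost ]
                (∀ {n} (ρ : Env n Γ) → Run n p (unary n ∙ encEnv ρ) (encEnv (evals ts ρ)) b)
  compileArgs []       = _ , _ , λ ρ → nilᴿ
  compileArgs (t ∷ ts) = _ , _ , λ ρ → consᴿ (run t ρ) (proj₂ (proj₂ (compileArgs ts)) ρ)

  run : ∀ {Γ τ} (t : Term Γ τ) {n} (ρ : Env n Γ) →
        Run n (proj₁ (compile t)) (unary n ∙ encEnv ρ) (enc τ (eval t ρ)) (proj₁ (proj₂ (compile t)))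
  run t = proj₂ (proj₂ (compile t))

-- Graphs as input and output

adjacency : ∀ {n} → Graph n → Vec (Vec Bool n) n
adjacency G = tabulate λ u → tabulate (adj G u)

adjacency-adj : ∀ {n} (G : Graph n) u v → adj G u v ≡ lookup (lookup (adjacency G) u) v
adjacency-adj G u v = sym (trans (cong (λ r → lookup r v) (lookup∘tabulate (λ u → tabulate (adj G u)) u))
                                 (lookup∘tabulate (adj G u) v))

encVec-lookup : ∀ {n m} τ (v : Vec (Val n τ) m) → encodeList (List.tabulate (enc τ ∘ lookup v)) ≡ encVec τ v
encVec-lookup τ []      = refl
encVec-lookup τ (v ∷ w) = cong (enc τ v ∙_) (encVec-lookup τ w)

encode-matrix : ∀ {n} (G : Graph n) (A : Vec (Vec Bool n) n) →
                (∀ u v → adj G u v ≡ lookup (lookup A u) v) → encode G ≡ enc (tab (tab bool)) A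
encode-matrix {n} G A eq = trans
  (cong encodeList (List.tabulate-cong λ u → trans
    (cong encodeList (List.tabulate-cong λ v → cong encodeBool (eq u v)))
    (encVec-lookup {n} bool (lookup A u))))
  (encVec-lookup (tab bool) A)

countLoop : Program
countLoop = while hd loop cons (hd ⨾ tl) (cons mknil tl)

countᴿ : ∀ {n} (xs : List Data) → List.length xs ≡ n → ∀ m →
         Run n countLoop (encodeList xs ∙ unary m) (nil ∙ unary (m + n)) (fixed 2 ⊞ N· (fixed 9))
countᴿ {n} xs refl m = let c , r , c≤ = go xs m in ran r c≤
  where
  go : ∀ xs m → ∃[ c ] (countLoop ⊢ encodeList xs ∙ unary m ⇓ nil ∙ unary (m + List.length xs) [ c ] ×
                        c ≤ 2 + List.length xs * 9)
  go []       m rewrite +-identityʳ m = _ , stop hd , ≤-refl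
  go (x ∷ xs) m rewrite +-suc m (List.length xs) with go xs (suc m)
  ... | c , r , c≤ = _ , loop hd (cons (seq hd tl) (cons mknil tl)) r , +-monoʳ-≤ 9 c≤

prelude : Σ[ p ∈ Program ] Σ[ b ∈ Cost ] (∀ {n} (G : Graph n) →
          Run n p (encode G) (unary n ∙ encEnv {n} {tab (tab bool) ∷ []} (adjacency G ∷ [])) b)
prelude = _ , _ , λ {n} G →
  substᴿ (cong (λ d → unary n ∙ (d ∙ nil)) (encode-matrix G (adjacency G) (adjacency-adj G)))
    (consᴿ ((consᴿ skipᴿ nilᴿ ⨾ᴿ countᴿ (rows G) (List.length-tabulate (row G)) 0) ⨾ᴿ tlᴿ)
           (consᴿ skipᴿ nilᴿ))
  where
  row : ∀ {n} → Graph n → Fin n → Data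
  row G u = encodeList (List.tabulate λ v → encodeBool (adj G u v))
  rows : ∀ {n} → Graph n → List Data
  rows G = List.tabulate (row G)

-- `encode G` contains no numeral for `n`, so `prelude` counts the rows first. One pair `a`, `e`
-- serves all graphs because the cost is fixed by the term.
realize : (t : Term (tab (tab bool) ∷ []) (tab (tab bool))) →
  Σ[ p ∈ Program ] Σ[ a ∈ ℕ ] Σ[ e ∈ ℕ ]
    (∀ {n} → 1 ≤ n → (G H : Graph n) →
     (∀ u v → adj H u v ≡ lookup (lookup (eval t (adjacency G ∷ [])) u) v) →
     Σ[ c ∈ ℕ ] (p ⊢ encode G ⇓ encode H [ c ] × c ≤ a * n ^ e))
realize t with prelude | compile t
... | p , b , prelude | q , b′ , body with at-polynomial (fixed 1 ⊞ (b ⊞ b′))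
... | a , e , bound = (p ⨾ q) , a , e , λ {n} 1≤n G H eq →
  let r = prelude G ⨾ᴿ substᴿ (sym (encode-matrix H _ eq)) (body (adjacency G ∷ []))
  in Run.steps r , Run.halts r , ≤-trans (Run.bounded r) (bound n 1≤n)

-- The algorithm as a term

bit : Bool → ℕ
bit false = 0
bit true  = 1

count : ∀ {n} → (Fin n → Bool) → ℕ
count f = sum (λ i → bit (f i))

set mat : Ty
set = tab bool
mat = tab set

v0 : ∀ {Γ a} → Term (a ∷ Γ) a
v0 = var here
v1 : ∀ {Γ a b} → Term (a ∷ b ∷ Γ) b
v1 = var (there here)
v2 : ∀ {Γ a b c} → Term (a ∷ b ∷ c ∷ Γ) c
v2 = var (there (there here))
v3 : ∀ {Γ a b c d} → Term (a ∷ b ∷ c ∷ d ∷ Γ) d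
v3 = var (there (there (there here)))
v4 : ∀ {Γ a b c d e} → Term (a ∷ b ∷ c ∷ d ∷ e ∷ Γ) e
v4 = var (there (there (there (there here))))
v5 : ∀ {Γ a b c d e f} → Term (a ∷ b ∷ c ∷ d ∷ e ∷ f ∷ Γ) f
v5 = var (there (there (there (there (there here)))))

-- Holds, _∈ˢ_ and Edge are records, and terms are opaque, so that unification
-- can recover sets and matrices from statements about their members.
record Holds (b : Bool) : Set where
  constructor holds
  field true! : T b

open Holds

infix 4 _∈ˢ_
record _∈ˢ_ {n} (u : Fin n) (X : Val n set) : Set where
  constructor mem
  field member : Holds (lookup X u)

open _∈ˢ_

record Edge {n} (K : Val n mat) (u v : Fin n) : Set where
  constructor edge
  field target : v ∈ˢ lookup K u

open Edge

⇔-id : ∀ {P : Set} → P ⇔ P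
⇔-id = mk⇔ id id

⇔-map : ∀ {P Q R : Set} → (P → Q) → (Q → P) → Q ⇔ R → P ⇔ R
⇔-map f g q = mk⇔ (to q ∘ f) (g ∘ from q)

opaque
  andT orT : Term (bool ∷ bool ∷ []) bool
  andT = ite v0 v1 ff
  orT  = ite v0 tt v1

  negT : Term (bool ∷ []) bool
  negT = ite v0 ff tt

  leT eqT : Term (idx ∷ idx ∷ []) bool
  leT = leq v0 v1
  eqT = ite (leq v0 v1) (leq v1 v0) ff

  someT : Term (set ∷ []) bool
  someT = fold ff (ite (get v2 v1) tt v0)

infixr 6 _and_
infixr 5 _or_
_and_ _or_ : ∀ {Γ} → Term Γ bool → Term Γ bool → Term Γ bool
a and b = call andT (a ∷ b ∷ [])
a or b  = call orT (a ∷ b ∷ [])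

neg : ∀ {Γ} → Term Γ bool → Term Γ bool
neg a = call negT (a ∷ [])

le eq : ∀ {Γ} → Term Γ idx → Term Γ idx → Term Γ bool
le i j = call leT (i ∷ j ∷ [])
eq i j = call eqT (i ∷ j ∷ [])

any : ∀ {Γ} → Term (idx ∷ Γ) bool → Term Γ bool
any t = call someT (table t ∷ [])

T-isZero : ∀ {a b} → T (isZero (a ∸ b)) ⇔ (a ≤ b)
T-isZero {zero}  {b}     = mk⇔ (λ _ → z≤n) (λ _ → subst (T ∘ isZero) (sym (0∸n≡0 b)) _)
T-isZero {suc a} {zero}  = mk⇔ (λ ()) (λ ())
T-isZero {suc a} {suc b} = mk⇔ (s≤s ∘ to T-isZero) (from T-isZero ∘ s≤s⁻¹)

T-or : ∀ {a b} {P Q : Set} → T a ⇔ P → T b ⇔ Q → T (ifᵇ a then true else b) ⇔ (P ⊎ Q)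
T-or {true}  p q = mk⇔ (λ _ → inj₁ (to p _)) _
T-or {false} p q = mk⇔ (inj₂ ∘ to q) [ ⊥-elim ∘ from p , from q ]′

T-any : ∀ {m} (f : Fin m → Bool) →
        T (repeat m (λ i b → ifᵇ f i then true else b) false) ⇔ (∃[ i ] T (f i))
T-any {zero}  f = mk⇔ (λ ()) (λ ())
T-any {suc m} f = mk⇔
  (λ t → [ (zero ,_) , (λ (i , q) → suc i , q) ]′ (to b t))
  (λ { (zero , q) → from b (inj₁ q) ; (suc i , q) → from b (inj₂ (i , q)) })
  where b = T-or {f zero} ⇔-id (T-any (f ∘ suc))

-- The `⊨` lemmas match term formers with connectives on propositions. The membership lemma of a set
-- term is then composed along the syntax of that term.
⊨table : ∀ {n} {f : Fin n → Bool} {u} {P : Set} → Holds (f u) ⇔ P → u ∈ˢ tabulate f ⇔ P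
⊨table {f = f} {u} = ⇔-map (λ m → subst Holds (lookup∘tabulate f u) (member m))
                           (λ h → mem (subst Holds (sym (lookup∘tabulate f u)) h))

⊨row : ∀ {n} {f : Fin n → Val n set} {u v} {P : Set} → v ∈ˢ f u ⇔ P → Edge (tabulate f) u v ⇔ P
⊨row {f = f} {u} {v} = ⇔-map (λ m → subst (v ∈ˢ_) (lookup∘tabulate f u) (target m))
                             (λ h → edge (subst (v ∈ˢ_) (sym (lookup∘tabulate f u)) h))

⊨∈ : ∀ {n} {X : Val n set} {u} → Holds (lookup X u) ⇔ (u ∈ˢ X)
⊨∈ = mk⇔ mem member

⊨Edge : ∀ {n} {K : Val n mat} {u v} → Holds (lookup (lookup K u) v) ⇔ Edge K u v
⊨Edge = mk⇔ (edge ∘ mem) (member ∘ target)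

opaque
  unfolding andT
  ⊨and : ∀ {n a b} {P Q : Set} → Holds a ⇔ P → Holds b ⇔ Q → Holds (eval {n} andT (a ∷ b ∷ [])) ⇔ (P × Q)
  ⊨and {a = true}  p q = mk⇔ (λ t → to p _ , to q t) (λ (_ , y) → from q y)
  ⊨and {a = false} p q = mk⇔ (λ ()) (λ (x , _) → ⊥-elim (true! (from p x)))

  ⊨or : ∀ {n a b} {P Q : Set} → Holds a ⇔ P → Holds b ⇔ Q → Holds (eval {n} orT (a ∷ b ∷ [])) ⇔ (P ⊎ Q)
  ⊨or {a = true}  p q = mk⇔ (λ _ → inj₁ (to p _)) _
  ⊨or {a = false} p q = mk⇔ (inj₂ ∘ to q) [ ⊥-elim ∘ true! ∘ from p , from q ]′

  ⊨neg : ∀ {n a} {P : Set} → Holds a ⇔ P → Holds (eval {n} negT (a ∷ [])) ⇔ (¬ P)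
  ⊨neg {a = true}  p = mk⇔ (λ ()) (λ ¬p → ⊥-elim (¬p (to p _)))
  ⊨neg {a = false} p = mk⇔ (λ _ → true! ∘ from p) _

  ⊨le : ∀ {n i j} → Holds (eval {n} leT (i ∷ j ∷ [])) ⇔ (toℕ i ≤ toℕ j)
  ⊨le = mk⇔ (to T-isZero ∘ true!) (holds ∘ from T-isZero)

  ⊨eq : ∀ {n i j} → Holds (eval {n} eqT (i ∷ j ∷ [])) ⇔ (i ≡ j)
  ⊨eq {i = i} {j} = mk⇔
    (λ t → let l , l′ = to both t in Fin.toℕ-injective
                 (≤-antisym (to T-isZero (true! l)) (to T-isZero (true! l′))))
    (λ e → from both (holds (from T-isZero (≤-reflexive (cong toℕ e)))
                    , holds (from T-isZero (≤-reflexive (cong toℕ (sym e))))))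
    where
    both : Holds (ifᵇ isZero (toℕ i ∸ toℕ j) then isZero (toℕ j ∸ toℕ i) else false) ⇔
           (Holds (isZero (toℕ i ∸ toℕ j)) × Holds (isZero (toℕ j ∸ toℕ i)))
    both = ⊨and {0} ⇔-id ⇔-id

  ⊨any : ∀ {n} {f : Fin n → Bool} {P : Fin n → Set} →
         (∀ i → Holds (f i) ⇔ P i) → Holds (eval someT (tabulate f ∷ [])) ⇔ (∃[ i ] P i)
  ⊨any {f = f} p = mk⇔
    (λ b → let i , q = to (T-any (lookup (tabulate f))) (true! b) in i ,
                 to (⊨table {f = f} (p i)) (mem (holds q)))
    (λ (i , q) → holds (from (T-any (lookup (tabulate f)))
        (i , true! (member (from (⊨table {f = f} (p i)) q)))))

repeat-suc² : ∀ {m} (f : Fin m → Bool) → repeat m (λ i s → ifᵇ f i then suc (suc s) else s) 0 ≡ 2 * count f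
repeat-suc² {zero}  f = refl
repeat-suc² {suc m} f with f zero
... | true  = trans (cong (2 +_) (repeat-suc² (f ∘ suc))) (sym (*-suc 2 (count (f ∘ suc))))
... | false = repeat-suc² (f ∘ suc)

repeat-pred : ∀ {m} (f : Fin m → Bool) s → repeat m (λ i s → ifᵇ f i then pred s else s) s ≡ s ∸ count f
repeat-pred {zero}  f s = refl
repeat-pred {suc m} f s with f zero
... | true  = trans (cong pred (repeat-pred (f ∘ suc) s)) (pred[m∸n]≡m∸[1+n] s (count (f ∘ suc)))
... | false = repeat-pred (f ∘ suc) s

opaque
  singletonT : Term (idx ∷ []) set
  singletonT = table (eq v0 v1)

opaque
  unfolding singletonT
  ∈-singleton : ∀ {n} {v u : Fin n} → u ∈ˢ eval singletonT (v ∷ []) ⇔ (u ≡ v)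
  ∈-singleton {v = v} = ⊨table ⊨eq

opaque
  growT : Term (set ∷ mat ∷ []) set
  growT = table (get v1 v0 or any (get v2 v0 and get (get v3 v0) v1))

opaque
  unfolding growT
  ∈-grow : ∀ {n X K} {u : Fin n} → u ∈ˢ eval growT (X ∷ K ∷ []) ⇔ (u ∈ˢ X ⊎ (∃[ w ] (w ∈ˢ X × Edge K w u)))
  ∈-grow = ⊨table (⊨or ⊨∈ (⊨any λ _ → ⊨and ⊨∈ ⊨Edge))

opaque
  reachT : Term (set ∷ mat ∷ []) set
  reachT = fold v0 (call growT (v0 ∷ v3 ∷ []))

opaque
  maskT : Term (set ∷ mat ∷ []) mat
  maskT = table (table ((get v2 v1 and get v2 v0) and get (get v3 v1) v0))

opaque
  unfolding maskT
  Edge-mask : ∀ {n A g} {u w : Fin n} → Edge (eval maskT (A ∷ g ∷ [])) u w ⇔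
      ((u ∈ˢ A × w ∈ˢ A) × Edge g u w)
  Edge-mask {A = A} {g} {u} {w} = ⊨row (⊨table (⊨and (⊨and ⊨∈ ⊨∈) ⊨Edge))

opaque
  coverT : Term (set ∷ mat ∷ []) set
  coverT = table (any (get v2 v0 and get (get v3 v0) v1))

opaque
  unfolding coverT
  ∈-cover : ∀ {n C B} {u : Fin n} → u ∈ˢ eval coverT (C ∷ B ∷ []) ⇔ (∃[ c ] (c ∈ˢ C × Edge B c u))
  ∈-cover = ⊨table (⊨any λ _ → ⊨and ⊨∈ ⊨Edge)

opaque
  diffT : Term (set ∷ set ∷ []) set
  diffT = table (get v1 v0 and neg (get v2 v0))

opaque
  unfolding diffT
  ∈-diff : ∀ {n A D} {u : Fin n} → u ∈ˢ eval diffT (A ∷ D ∷ []) ⇔ (u ∈ˢ A × ¬ u ∈ˢ D)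
  ∈-diff = ⊨table (⊨and ⊨∈ (⊨neg ⊨∈))

opaque
  interT : Term (set ∷ set ∷ []) set
  interT = table (get v1 v0 and get v2 v0)

opaque
  unfolding interT
  ∈-inter : ∀ {n A D} {u : Fin n} → u ∈ˢ eval interT (A ∷ D ∷ []) ⇔ (u ∈ˢ A × u ∈ˢ D)
  ∈-inter = ⊨table (⊨and ⊨∈ ⊨∈)

opaque
  insertT : Term (set ∷ idx ∷ []) set
  insertT = table (get v1 v0 or eq v0 v2)

opaque
  unfolding insertT
  ∈-insert : ∀ {n C} {v u : Fin n} → u ∈ˢ eval insertT (C ∷ v ∷ []) ⇔ (u ∈ˢ C ⊎ u ≡ v)
  ∈-insert {C = C} {v} {u} = ⊨table (⊨or ⊨∈ ⊨eq)

opaque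
  emptyT : Term [] set
  emptyT = table ff

opaque
  unfolding emptyT
  ∉-empty : ∀ {n} {u : Fin n} → ¬ u ∈ˢ eval emptyT []
  ∉-empty = true! ∘ to (⊨table ⇔-id)

opaque
  fullT : Term [] set
  fullT = table tt

opaque
  unfolding fullT
  ∈-full : ∀ {n} {u : Fin n} → u ∈ˢ eval fullT []
  ∈-full = from (⊨table ⇔-id) _

opaque
  -- Counts 2 |B| up and then |A| down; pred truncates at 0.
  halfT : Term (set ∷ set ∷ []) bool
  halfT = isz (fold (fold zer (ite (get v3 v1) (suc′ (suc′ v0)) v0)) (ite (get v2 v1) (pred′ v0) v0))

opaque
  unfolding halfT
  ⊨half : ∀ {n A B} → Holds (eval {n} halfT (A ∷ B ∷ [])) ⇔ (2 * count (lookup B) ≤ count (lookup A))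
  ⊨half {A = A} {B}
    rewrite repeat-pred (lookup A) (repeat _ (λ i s → ifᵇ lookup B i then suc (suc s) else s) 0)
          | repeat-suc² (lookup B) = mk⇔ (to T-isZero ∘ true!) (holds ∘ from T-isZero)

opaque
  splitT : Term (set ∷ set ∷ mat ∷ []) bool
  splitT = neg (any (get v2 v0 and neg (call halfT
      (v1 ∷ call reachT (call singletonT (v0 ∷ []) ∷ v3 ∷ []) ∷ []))))

opaque
  unfolding splitT
  ⊨split : ∀ {n A R K} → Holds (eval {n} splitT (A ∷ R ∷ K ∷ [])) ⇔
    (¬ (∃[ a ] (a ∈ˢ R × ¬ 2 * count (lookup (eval reachT (eval singletonT (a ∷ []) ∷ K ∷ []))) ≤ count
        (lookup A))))
  ⊨split = ⊨neg (⊨any λ a → ⊨and ⊨∈ (⊨neg ⊨half))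

restT : Term (set ∷ mat ∷ mat ∷ set ∷ []) set
restT = call diffT (v0 ∷ call coverT (v3 ∷ v2 ∷ []) ∷ [])

opaque
  balancedT : Term (set ∷ mat ∷ mat ∷ set ∷ []) bool
  balancedT = call splitT (v0 ∷ restT ∷ call maskT (restT ∷ v1 ∷ []) ∷ [])

opaque
  unfolding balancedT
  ⊨balanced : ∀ {n A g B C} → let R = eval diffT (A ∷ eval coverT (C ∷ B ∷ []) ∷ []) in
    Holds (eval {n} balancedT (A ∷ g ∷ B ∷ C ∷ [])) ⇔
    (¬ (∃[ a ] (a ∈ˢ R × ¬ 2 * count (lookup (eval reachT
        (eval singletonT (a ∷ []) ∷ eval maskT (R ∷ g ∷ []) ∷ [])))
                      ≤ count (lookup A))))
  ⊨balanced = ⊨split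

opaque
  -- A deterministic choice of at most one member. It gives each vertex at most one parent in a
  -- forest, on which the edge count rests.
  firstT : Term (set ∷ []) set
  firstT = table (get v1 v0 and neg (any (get v2 v0 and neg (le v1 v0))))

opaque
  unfolding firstT
  ∈-first : ∀ {n P} {u : Fin n} → u ∈ˢ eval firstT (P ∷ []) ⇔
      (u ∈ˢ P × ¬ (∃[ w ] (w ∈ˢ P × ¬ toℕ u ≤ toℕ w)))
  ∈-first = ⊨table (⊨and ⊨∈ (⊨neg (⊨any λ _ → ⊨and ⊨∈ (⊨neg ⊨le))))

opaque
  neighbourT : Term (set ∷ mat ∷ idx ∷ []) set
  neighbourT = call firstT (table (get v1 v0 and get (get v2 v0) v3) ∷ [])

opaque
  -- The state is a layer together with the parents chosen so far. Rows of vertices in the layer are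
  -- frozen; any other row is recomputed and becomes nonempty once its vertex has a neighbour in the
  -- layer, that is, when it enters the next one.
  layerStepT : Term ((set ⊗ mat) ∷ mat ∷ []) (set ⊗ mat)
  layerStepT = pair (call growT (fst v0 ∷ v1 ∷ []))
                    (table (ite (get (fst v1) v0) (get (snd v1) v0)
                        (call neighbourT (fst v1 ∷ v2 ∷ v0 ∷ []))))

opaque
  forestT : Term (set ∷ mat ∷ []) mat
  forestT = snd (fold (pair v0 (table (call emptyT []))) (call layerStepT (v0 ∷ v3 ∷ [])))

opaque
  -- The context is the partial choice of centres, A, the adjacency matrix of
  -- G, and the matrix of balls of the current radius.
  searchT : ℕ → Term (set ∷ set ∷ mat ∷ mat ∷ []) (bool ⊗ set)
  searchT zero    = pair (call balancedT (v1 ∷ v2 ∷ v3 ∷ v0 ∷ [])) v0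
  searchT (suc k) = fold (pair ff v0)
    (ite (fst v0) v0 (call (searchT k) (call insertT (v2 ∷ v1 ∷ []) ∷ v3 ∷ v4 ∷ v5 ∷ [])))

opaque
  growBallsT : Term (mat ∷ mat ∷ []) mat
  growBallsT = table (call growT (get v1 v0 ∷ v2 ∷ []))

opaque
  ballsT : Term [] mat
  ballsT = table (call singletonT (v0 ∷ []))

opaque
  decideT : Term ((bool ⊗ set) ∷ mat ∷ mat ∷ []) (bool ⊗ set ⊗ mat)
  decideT = ite (fst v0) (pair tt (pair (snd v0) v1))
      (pair ff (pair (snd v0) (call growBallsT (v1 ∷ v2 ∷ []))))

opaque
  sepStepT : ℕ → Term ((bool ⊗ set ⊗ mat) ∷ set ∷ mat ∷ []) (bool ⊗ set ⊗ mat)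
  sepStepT k = ite (fst v0) v0
    (call decideT (call (searchT k) (call emptyT [] ∷ v1 ∷ v2 ∷ snd (snd v0) ∷ []) ∷ snd (snd v0) ∷ v2 ∷
        []))

opaque
  -- The step after the fold tries radius n, at which balls no longer grow.
  sepT : ℕ → Term (set ∷ mat ∷ []) (set ⊗ mat)
  sepT k = snd (call (sepStepT k)
    (fold (pair ff (pair (call emptyT []) (call ballsT []))) (call (sepStepT k) (v0 ∷ v2 ∷ v3 ∷ [])) ∷
        v0 ∷ v1 ∷ []))

opaque
  -- The context is A, its separator, the adjacency matrix of G[A], and u.
  parentsT : Term (set ∷ (set ⊗ mat) ∷ mat ∷ idx ∷ []) set
  parentsT = table (any (get (fst v3) v0 and
    (get (get (call forestT (call interT (v2 ∷ get (snd v3) v0 ∷ []) ∷ v4 ∷ [])) v5) v1 or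
     get (get (call forestT (call interT (v2 ∷ call singletonT (v0 ∷ []) ∷ []) ∷ v4 ∷ [])) v5) v1)))

opaque
  pieceT : Term (set ∷ mat ∷ idx ∷ []) set
  pieceT = call reachT (call singletonT (v2 ∷ []) ∷ call maskT (v0 ∷ v1 ∷ []) ∷ [])

opaque
  linksT : ℕ → Term (set ∷ mat ∷ idx ∷ []) set
  linksT k = call parentsT (v0 ∷ call (sepT k) (v0 ∷ v1 ∷ []) ∷ call maskT (v0 ∷ v1 ∷ []) ∷ v2 ∷ [])

diskT : Term ((set ⊗ mat) ∷ []) set
diskT = call coverT (fst v0 ∷ snd v0 ∷ [])

opaque
  separatorT : ℕ → Term (set ∷ mat ∷ []) set
  separatorT k = call diskT (call (sepT k) (v0 ∷ v1 ∷ []) ∷ [])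

opaque
  -- Every vertex computes the separator and the forests of its own piece anew. Vertices of one
  -- piece agree on them, since the results depend on the piece and the graph only.
  levelT : ℕ → Term ((set ⊗ mat) ∷ mat ∷ []) (set ⊗ mat)
  levelT k = pair
    (table (get (fst v1) v0 and
            neg (get (call (separatorT k) (call pieceT (fst v1 ∷ v2 ∷ v0 ∷ []) ∷ v2 ∷ [])) v0)))
    (table (table (get (get (snd v2) v1) v0 or
      (get (fst v2) v1 and get (call (linksT k) (call pieceT (fst v2 ∷ v3 ∷ v1 ∷ []) ∷ v3 ∷ v1 ∷ [])) v0))))

opaque
  symmetriseT : Term (mat ∷ []) mat
  symmetriseT = table (table (get (get v2 v1) v0 or get (get v2 v0) v1))

opaque
  -- A `fold` makes `n` rounds, at least as many as the levels needed; the remaining ones find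
  -- nothing left to delete.
  spannerT : ℕ → Term (mat ∷ []) mat
  spannerT k = call symmetriseT
    (snd (fold (pair (call fullT []) (table (call emptyT []))) (call (levelT k) (v0 ∷ v2 ∷ []))) ∷ [])

-- Paths, layers and breadth-first forests

Holds? : ∀ b → Dec (Holds b)
Holds? b = map′ holds true! (T? b)

_∈ˢ?_ : ∀ {n} (u : Fin n) (X : Val n set) → Dec (u ∈ˢ X)
u ∈ˢ? X = map′ mem member (Holds? (lookup X u))

infix 4 _⊆ˢ_
_⊆ˢ_ : ∀ {n} → Val n set → Val n set → Set
X ⊆ˢ Y = ∀ {u} → u ∈ˢ X → u ∈ˢ Y

size : ∀ {n} → Val n set → ℕ
size X = count (lookup X)

sum-mono : ∀ {n} {f g : Fin n → ℕ} → (∀ i → f i ≤ g i) → sum f ≤ sum g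
sum-mono {zero}  p = z≤n
sum-mono {suc n} p = +-mono-≤ (p zero) (sum-mono (p ∘ suc))

sum-const : ∀ n c → sum {n} (λ _ → c) ≡ n * c
sum-const zero    c = refl
sum-const (suc n) c = cong (c +_) (sum-const n c)

bit-mono : ∀ {a b} → (Holds a → Holds b) → bit a ≤ bit b
bit-mono {false}         p = z≤n
bit-mono {true}  {true}  p = ≤-refl
bit-mono {true}  {false} p = ⊥-elim (true! (p _))

count-mono : ∀ {n} {f g : Fin n → Bool} → (∀ i → Holds (f i) → Holds (g i)) → count f ≤ count g
count-mono p = sum-mono λ i → bit-mono (p i)

size-mono : ∀ {n} {X Y : Val n set} → X ⊆ˢ Y → size X ≤ size Y
size-mono {X = X} {Y} p = count-mono {f = lookup X} {lookup Y} λ i h → member (p (mem h))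

bit≤1 : ∀ b → bit b ≤ 1
bit≤1 false = z≤n
bit≤1 true  = ≤-refl

count≤n : ∀ {n} (f : Fin n → Bool) → count f ≤ n
count≤n {n} f = subst (count f ≤_) (trans (sum-const n 1) (*-identityʳ n)) (sum-mono λ i → bit≤1 (f i))

size≥1 : ∀ {n} {X : Val n set} {u} → u ∈ˢ X → 1 ≤ size X
size≥1 {X = true ∷ X}          m = s≤s z≤n
size≥1 {X = false ∷ X} {zero}  m = ⊥-elim (true! (member m))
size≥1 {X = false ∷ X} {suc u} m = size≥1 {X = X} (mem (member m))

⊆ˢ⇒≡⊎< : ∀ {n m} (X Y : Vec Bool n) → (∀ i → Holds (lookup X i) → Holds (lookup Y i)) →
         m ≡ n → X ≡ Y ⊎ count (lookup X) < count (lookup Y)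
⊆ˢ⇒≡⊎< []      []      p e = inj₁ refl
⊆ˢ⇒≡⊎< (x ∷ X) (y ∷ Y) p refl with ⊆ˢ⇒≡⊎< X Y (p ∘ suc) refl
⊆ˢ⇒≡⊎< (true  ∷ X) (true  ∷ Y) p refl | inj₁ refl = inj₁ refl
⊆ˢ⇒≡⊎< (false ∷ X) (false ∷ Y) p refl | inj₁ refl = inj₁ refl
⊆ˢ⇒≡⊎< (false ∷ X) (true  ∷ Y) p refl | inj₁ refl = inj₂ ≤-refl
⊆ˢ⇒≡⊎< (true  ∷ X) (false ∷ Y) p refl | _         = ⊥-elim (true! (p zero _))
⊆ˢ⇒≡⊎< (true  ∷ X) (true  ∷ Y) p refl | inj₂ l    = inj₂ (s≤s l)
⊆ˢ⇒≡⊎< (false ∷ X) (false ∷ Y) p refl | inj₂ l    = inj₂ l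
⊆ˢ⇒≡⊎< (false ∷ X) (true  ∷ Y) p refl | inj₂ l    = inj₂ (m≤n⇒m≤1+n l)

least : (P : ℕ → Set) → (∀ m → Dec (P m)) → ∀ m → P m → ∃[ d ] (P d × (∀ ℓ → P ℓ → d ≤ ℓ))
least P P? m p = [ id , (λ none → ⊥-elim (none m (n<1+n m) p)) ]′ (below (suc m))
  where
  below : ∀ m → (∃[ d ] (P d × (∀ ℓ → P ℓ → d ≤ ℓ))) ⊎ (∀ ℓ → ℓ < m → ¬ P ℓ)
  below zero = inj₂ λ _ ()
  below (suc m) with below m
  ... | inj₁ found = inj₁ found
  ... | inj₂ none with P? m
  ...   | yes q = inj₁ (m , q , λ ℓ r → ≮⇒≥ λ ℓ<m → none ℓ ℓ<m r)
  ...   | no ¬q = inj₂ λ ℓ ℓ<1+m → [ none ℓ , (λ { refl → ¬q }) ]′ (m<1+n⇒m<n∨m≡n ℓ<1+m)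

data Path {V : Set} (E : V → V → Set) : V → V → ℕ → Set where
  []  : ∀ {u} → Path E u u 0
  _∷_ : ∀ {u v w ℓ} → E u v → Path E v w ℓ → Path E u w (suc ℓ)

module _ {V : Set} {E : V → V → Set} where
  infixr 5 _++ᴾ_
  _++ᴾ_ : ∀ {u v w k ℓ} → Path E u v k → Path E v w ℓ → Path E u w (k + ℓ)
  []      ++ᴾ q = q
  (e ∷ p) ++ᴾ q = e ∷ (p ++ᴾ q)

  infixl 5 _∷ʳᴾ_
  _∷ʳᴾ_ : ∀ {u v w ℓ} → Path E u v ℓ → E v w → Path E u w (suc ℓ)
  []      ∷ʳᴾ f = f ∷ []
  (e ∷ p) ∷ʳᴾ f = e ∷ (p ∷ʳᴾ f)

  reverseᴾ : (∀ {u v} → E u v → E v u) → ∀ {u v ℓ} → Path E u v ℓ → Path E v u ℓ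
  reverseᴾ s []      = []
  reverseᴾ s (e ∷ p) = reverseᴾ s p ∷ʳᴾ s e

  initᴾ : ∀ {u w ℓ} → Path E u w (suc ℓ) → ∃[ v ] (Path E u v ℓ × E v w)
  initᴾ (e ∷ [])      = _ , [] , e
  initᴾ (e ∷ (f ∷ p)) with initᴾ (f ∷ p)
  ... | v , q , g = v , e ∷ q , g

mapᴾ : ∀ {V} {E F : V → V → Set} → (∀ {u v} → E u v → F u v) → ∀ {u v ℓ} → Path E u v ℓ → Path F u v ℓ
mapᴾ f []      = []
mapᴾ f (e ∷ p) = f e ∷ mapᴾ f p

module _ {n : ℕ} where
  singleton : Fin n → Val n set
  singleton v = eval singletonT (v ∷ [])

  grow : Val n mat → Val n set → Val n set
  grow K X = eval growT (X ∷ K ∷ [])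

  layer : Val n mat → Val n set → ℕ → Val n set
  layer K X m = repeat m (λ _ → grow K) X

  reach : Val n mat → Val n set → Val n set
  reach K X = eval reachT (X ∷ K ∷ [])

  within : Val n mat → Val n set → ℕ → Fin n → Set
  within K X m u = ∃[ x ] ∃[ ℓ ] (x ∈ˢ X × ℓ ≤ m × Path (Edge K) x u ℓ)

  ∈-layer : ∀ K X m {u} → u ∈ˢ layer K X m ⇔ within K X m u
  ∈-layer K X zero = mk⇔ (λ h → _ , 0 , h , z≤n , []) λ { (_ , _ , h , z≤n , []) → h }
  ∈-layer K X (suc m) = mk⇔ (forth ∘ to ∈-grow) (from ∈-grow ∘ back)
    where
    forth : ∀ {u} → u ∈ˢ layer K X m ⊎ (∃[ w ] (w ∈ˢ layer K X m × Edge K w u)) → within K X (suc m) u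
    forth (inj₁ h) with to (∈-layer K X m) h
    ... | x , ℓ , hx , ℓ≤m , p = x , ℓ , hx , m≤n⇒m≤1+n ℓ≤m , p
    forth (inj₂ (w , h , e)) with to (∈-layer K X m) h
    ... | x , ℓ , hx , ℓ≤m , p = x , suc ℓ , hx , s≤s ℓ≤m , p ∷ʳᴾ e
    back : ∀ {u} → within K X (suc m) u → u ∈ˢ layer K X m ⊎ (∃[ w ] (w ∈ˢ layer K X m × Edge K w u))
    back (x , zero , hx , _ , p) = inj₁ (from (∈-layer K X m) (x , zero , hx , z≤n , p))
    back (x , suc ℓ , hx , s≤s ℓ≤m , p) with initᴾ p
    ... | w , q , e = inj₂ (w , from (∈-layer K X m) (x , ℓ , hx , ℓ≤m , q) , e)

  layer-mono : ∀ K X {k m} → k ≤ m → layer K X k ⊆ˢ layer K X m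
  layer-mono K X {k} {m} k≤m h with to (∈-layer K X k) h
  ... | x , ℓ , hx , ℓ≤k , p = from (∈-layer K X m) (x , ℓ , hx , ≤-trans ℓ≤k k≤m , p)

  -- A strict inclusion adds a vertex, and a layer that stops growing never grows again. Hence
  -- layers still growing have at least as many vertices as steps, which forces saturation after `n`
  -- steps.
  layer-stable : ∀ K X m → layer K X (suc m) ≡ layer K X m ⊎ suc m ≤ size (layer K X (suc m))
  layer-stable K X m with ⊆ˢ⇒≡⊎< (layer K X m) (layer K X (suc m))
                           (λ i h → member (layer-mono K X (n≤1+n m) (mem h))) refl
  layer-stable K X m       | inj₁ eq = inj₁ (sym eq)
  layer-stable K X zero    | inj₂ l  = inj₂ (≤-trans (s≤s z≤n) l)
  layer-stable K X (suc m) | inj₂ l with layer-stable K X m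
  ... | inj₁ eq = inj₁ (cong (grow K) eq)
  ... | inj₂ l′ = inj₂ (≤-trans (s≤s l′) l)

  layer-saturates : ∀ K X d → layer K X (d + n) ≡ layer K X n
  layer-saturates K X zero    = refl
  layer-saturates K X (suc d) = trans (cong (grow K) (layer-saturates K X d))
    ([ id , (λ l → ⊥-elim (1+n≰n (≤-trans l (count≤n (lookup (layer K X (suc n))))))) ]′
        (layer-stable K X n))

  layer⊆layer-n : ∀ K X m → layer K X m ⊆ˢ layer K X n
  layer⊆layer-n K X m h = subst (_ ∈ˢ_) (layer-saturates K X m) (layer-mono K X (m≤m+n m n) h)

opaque
  unfolding reachT
  reach≡layer : ∀ {n} K (X : Val n set) → reach K X ≡ layer K X n
  reach≡layer K X = refl

∈-reach : ∀ {n} {K} {X : Val n set} {u} → u ∈ˢ reach K X ⇔ (∃[ x ] ∃[ ℓ ] (x ∈ˢ X × Path (Edge K) x u ℓ))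
∈-reach {n} {K} {X} {u} rewrite reach≡layer K X = mk⇔
  (λ h → let x , ℓ , hx , _ , p = to (∈-layer K X n) h in x , ℓ , hx , p)
  (λ (x , ℓ , hx , p) → layer⊆layer-n K X ℓ (from (∈-layer K X ℓ) (x , ℓ , hx , ≤-refl , p)))

module _ {n : ℕ} where
  neighbour : Val n set → Val n mat → Fin n → Val n set
  neighbour L K u = eval neighbourT (L ∷ K ∷ u ∷ [])

  layerStep : Val n mat → Val n (set ⊗ mat) → Val n (set ⊗ mat)
  layerStep K s = eval layerStepT (s ∷ K ∷ [])

  noEdges : Val n mat
  noEdges = tabulate λ _ → eval emptyT []

  layers : Val n mat → Val n set → ℕ → Val n (set ⊗ mat)
  layers K X m = repeat m (λ _ → layerStep K) (X , noEdges)

  forest : Val n set → Val n mat → Val n mat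
  forest X K = eval forestT (X ∷ K ∷ [])

first-exists : ∀ {n} {P : Val n set} {u} → u ∈ˢ P → ∃[ w ] w ∈ˢ eval firstT (P ∷ [])
first-exists {P = P} {u} h
  with least (λ m → ∃[ w ] (toℕ w ≡ m × w ∈ˢ P)) (λ m → Fin.any? λ w → (toℕ w ≟ m) ×-dec (w ∈ˢ? P))
      (toℕ u) (u , refl , h)
... | _ , (w , refl , h′) , min = w , from ∈-first
    (h′ , λ (x , hx , w≰x) → w≰x (min (toℕ x) (x , refl , hx)))

first-unique : ∀ {n} {P : Val n set} {u w} → u ∈ˢ eval firstT (P ∷ []) → w ∈ˢ eval firstT (P ∷ []) → u ≡ w
first-unique {u = u} {w} h h′ with to ∈-first h | to ∈-first h′
... | hu , u-min | hw , w-min = Fin.toℕ-injective (≤-antisym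
  (≮⇒≥ λ w<u → u-min (w , hw , <⇒≱ w<u)) (≮⇒≥ λ u<w → w-min (u , hu , <⇒≱ u<w)))

opaque
  unfolding neighbourT
  ∈-neighbour : ∀ {n} {L K} {u w : Fin n} → w ∈ˢ neighbour L K u → w ∈ˢ L × Edge K w u
  ∈-neighbour h = to (⊨table (⊨and ⊨∈ ⊨Edge)) (proj₁ (to ∈-first h))

  neighbour-exists : ∀ {n} {L K} {u w : Fin n} → w ∈ˢ L → Edge K w u → ∃[ w ] w ∈ˢ neighbour L K u
  neighbour-exists h e = first-exists (from (⊨table (⊨and ⊨∈ ⊨Edge)) (h , e))

  neighbour-unique : ∀ {n} {L K} {u w w′ : Fin n} → w ∈ˢ neighbour L K u → w′ ∈ˢ neighbour L K u → w ≡ w′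
  neighbour-unique = first-unique

opaque
  unfolding layerStepT
  layerStep-layer : ∀ {n} (K : Val n mat) s → proj₁ (layerStep K s) ≡ grow K (proj₁ s)
  layerStep-layer K s = refl

  layerStep-old : ∀ {n} {K : Val n mat} {s u} → u ∈ˢ proj₁ s →
      lookup (proj₂ (layerStep K s)) u ≡ lookup (proj₂ s) u
  layerStep-old {K = K} {L , E} {u} h with member h
  ... | h′ rewrite lookup∘tabulate (λ v → ifᵇ lookup L v then lookup E v else neighbour L K v) u with
      lookup L u
  ...   | true = refl

  layerStep-new : ∀ {n} {K : Val n mat} {s u} → ¬ u ∈ˢ proj₁ s →
      lookup (proj₂ (layerStep K s)) u ≡ neighbour (proj₁ s) K u
  layerStep-new {K = K} {L , E} {u} ¬h rewrite lookup∘tabulate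
      (λ v → ifᵇ lookup L v then lookup E v else neighbour L K v) u with lookup L u in eq
  ... | true  = ⊥-elim (¬h (mem (subst Holds (sym eq) _)))
  ... | false = refl

opaque
  unfolding forestT
  forest≡layers : ∀ {n} X (K : Val n mat) → forest X K ≡ proj₂ (layers K X n)
  forest≡layers X K = refl

layers≡layer : ∀ {n} K (X : Val n set) m → proj₁ (layers K X m) ≡ layer K X m
layers≡layer K X zero    = refl
layers≡layer K X (suc m) = trans (layerStep-layer K (layers K X m)) (cong (grow K) (layers≡layer K X m))

layers-row : ∀ {n} K (X : Val n set) m u →
             lookup (proj₂ (layers K X (suc m))) u ≡ lookup (proj₂ (layers K X m)) u ⊎
             lookup (proj₂ (layers K X (suc m))) u ≡ neighbour (layer K X m) K u
layers-row K X m u with u ∈ˢ? proj₁ (layers K X m)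
... | yes h = inj₁ (layerStep-old h)
... | no ¬h = inj₂ (trans (layerStep-new ¬h) (cong (λ L → neighbour L K u) (layers≡layer K X m)))

layers-edge : ∀ {n} K (X : Val n set) m {u w} → Edge (proj₂ (layers K X m)) u w → Edge K w u
layers-edge K X zero e = ⊥-elim (∉-empty (to (⊨row ⇔-id) e))
layers-edge K X (suc m) {u} {w} e with layers-row K X m u
... | inj₁ eq = layers-edge K X m (edge (subst (w ∈ˢ_) eq (target e)))
... | inj₂ eq = proj₂ (∈-neighbour (subst (w ∈ˢ_) eq (target e)))

layers-unique : ∀ {n} K (X : Val n set) m {u w w′} →
                Edge (proj₂ (layers K X m)) u w → Edge (proj₂ (layers K X m)) u w′ → w ≡ w′
layers-unique K X zero e e′ = ⊥-elim (∉-empty (to (⊨row ⇔-id) e))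
layers-unique K X (suc m) {u} {w} {w′} e e′ with layers-row K X m u
... | inj₁ eq = layers-unique K X m (edge (subst (w ∈ˢ_) eq (target e)))
    (edge (subst (w′ ∈ˢ_) eq (target e′)))
... | inj₂ eq = neighbour-unique (subst (w ∈ˢ_) eq (target e)) (subst (w′ ∈ˢ_) eq (target e′))

layers-persist : ∀ {n} K (X : Val n set) m d {u} → u ∈ˢ layer K X m →
                 lookup (proj₂ (layers K X (d + m))) u ≡ lookup (proj₂ (layers K X m)) u
layers-persist K X m zero    h = refl
layers-persist K X m (suc d) h = trans
  (layerStep-old (subst (_ ∈ˢ_) (sym (layers≡layer K X (d + m))) (layer-mono K X (m≤n+m m d) h)))
  (layers-persist K X m d h)

-- The row of `u` is fixed when `u` enters the layers and survives all later steps, whence the slack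
-- `d`. The parent lies in an earlier layer, so induction on `m` bounds the length.
layers-path : ∀ {n} K (X : Val n set) m d {u} → u ∈ˢ layer K X m →
              ∃[ x ] ∃[ ℓ ] (x ∈ˢ X × ℓ ≤ m × Path (Edge (proj₂ (layers K X (d + m)))) u x ℓ)
layers-path K X zero d h = _ , 0 , h , z≤n , []
layers-path K X (suc m) d {u} h with u ∈ˢ? layer K X m
... | yes h′ with layers-path K X m (suc d) h′
...   | x , ℓ , hx , ℓ≤m , p = x , ℓ , hx , m≤n⇒m≤1+n ℓ≤m ,
        subst (λ j → Path (Edge (proj₂ (layers K X j))) u x ℓ) (sym (+-suc d m)) p
layers-path K X (suc m) d {u} h | no ¬h with to ∈-grow h
... | inj₁ h′ = ⊥-elim (¬h h′)
... | inj₂ (w′ , hw′ , e′) with neighbour-exists hw′ e′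
...   | w , e with layers-path K X m (suc d) (proj₁ (∈-neighbour e))
...     | x , ℓ , hx , ℓ≤m , p = x , suc ℓ , hx , s≤s ℓ≤m ,
          edge (subst (w ∈ˢ_) (sym row) e) ∷
          subst (λ j → Path (Edge (proj₂ (layers K X j))) w x ℓ) (sym (+-suc d m)) p
  where
  row : lookup (proj₂ (layers K X (d + suc m))) u ≡ neighbour (layer K X m) K u
  row = trans (layers-persist K X (suc m) d h)
        (trans (layerStep-new (¬h ∘ subst (u ∈ˢ_) (layers≡layer K X m)))
               (cong (λ L → neighbour L K u) (layers≡layer K X m)))

module _ {n : ℕ} {X : Val n set} {K : Val n mat} where
  forest-edge : ∀ {u w} → Edge (forest X K) u w → Edge K w u
  forest-edge e = layers-edge K X n (subst (λ F → Edge F _ _) (forest≡layers X K) e)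

  forest-unique : ∀ {u w w′} → Edge (forest X K) u w → Edge (forest X K) u w′ → w ≡ w′
  forest-unique rewrite forest≡layers X K = layers-unique K X n

  forest-path : ∀ {x u ℓ} → x ∈ˢ X → Path (Edge K) x u ℓ →
                ∃[ y ] ∃[ k ] (y ∈ˢ X × k ≤ ℓ × Path (Edge (forest X K)) u y k)
  forest-path {x} {u} {ℓ} hx p rewrite forest≡layers X K with ≤-total ℓ n
  ... | inj₁ ℓ≤n with layers-path K X ℓ (n ∸ ℓ) (from (∈-layer K X ℓ) (x , ℓ , hx , ≤-refl , p))
  ...   | y , k , hy , k≤ℓ , q = y , k , hy , k≤ℓ ,
          subst (λ j → Path (Edge (proj₂ (layers K X j))) u y k) (m∸n+n≡m ℓ≤n) q
  -- For a path longer than `n` no further layers are needed: layer `n` already holds every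
  -- reachable vertex.
  forest-path {x} {u} {ℓ} hx p | inj₂ n≤ℓ
    with layers-path K X n 0 (layer⊆layer-n K X ℓ (from (∈-layer K X ℓ) (x , ℓ , hx , ≤-refl , p)))
  ... | y , k , hy , k≤n , q = y , k , hy , ≤-trans k≤n n≤ℓ , q

-- The search for a separator

-- A `fold` cannot stop early; once the flag is set, the later rounds hand the state on unchanged.
first-success : ∀ {m} {S : Set} (f : Fin m → Bool × S) c →
  let r = repeat m (λ i s → ifᵇ proj₁ s then s else f i) (false , c) in
  Holds (proj₁ r) → ∃[ i ] (Holds (proj₁ (f i)) × r ≡ f i)
first-success {suc m} f c h with repeat m (λ i s → ifᵇ proj₁ s then s else f (suc i)) (false , c) in eq
... | false , _ = zero , h , refl
... | true  , _ with first-success (f ∘ suc) c (subst (Holds ∘ proj₁) (sym eq) _)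
...   | i , hi , e = suc i , hi , trans (sym eq) e

success : ∀ {m} {S : Set} (f : Fin m → Bool × S) c i → Holds (proj₁ (f i)) →
          Holds (proj₁ (repeat m (λ i s → ifᵇ proj₁ s then s else f i) (false , c)))
success {suc m} f c i h with repeat m (λ i s → ifᵇ proj₁ s then s else f (suc i)) (false , c) in eq
success {suc m} f c i       h | true  , _ = _
success {suc m} f c zero    h | false , _ = h
success {suc m} f c (suc i) h | false , _ = ⊥-elim
    (true! (subst (Holds ∘ proj₁) eq (success (f ∘ suc) c i h)))

module _ {n : ℕ} where
  empty : Val n set
  empty = eval emptyT []

  insert : Val n set → Fin n → Val n set
  insert C v = eval insertT (C ∷ v ∷ [])

  insertAll : ∀ {k} → Val n set → Vec (Fin n) k → Val n set
  insertAll C []       = C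
  insertAll C (v ∷ vs) = insertAll (insert C v) vs

  Balanced : Val n set → Val n mat → Val n mat → Val n set → Set
  Balanced A g B C = Holds (eval balancedT (A ∷ g ∷ B ∷ C ∷ []))

  search : ℕ → Val n set → Val n set → Val n mat → Val n mat → Val n (bool ⊗ set)
  search k C A g B = eval (searchT k) (C ∷ A ∷ g ∷ B ∷ [])

opaque
  unfolding searchT
  search-sound : ∀ {n} k (C A : Val n set) g B → Holds (proj₁ (search k C A g B)) →
                 ∃[ vs ] (proj₂ (search k C A g B) ≡ insertAll {k = k} C vs × Balanced A g B
                     (insertAll C vs))
  search-sound zero    C A g B h = [] , refl , h
  search-sound (suc k) C A g B h with first-success (λ i → search k (insert C i) A g B) C h
  ... | i , hi , eq with search-sound k (insert C i) A g B hi
  ...   | vs , eq′ , b = i ∷ vs , trans (cong proj₂ eq) eq′ , b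

  search-complete : ∀ {n} k (C A : Val n set) g B (vs : Vec (Fin n) k) → Balanced A g B (insertAll C vs) →
                    Holds (proj₁ (search k C A g B))
  search-complete zero    C A g B []       b = b
  search-complete (suc k) C A g B (v ∷ vs) b =
    success (λ i → search k (insert C i) A g B) C v (search-complete k (insert C v) A g B vs b)

module _ {n : ℕ} where
  balls : Val n mat → ℕ → Val n mat
  balls g r = repeat r (λ _ B → eval growBallsT (B ∷ g ∷ [])) (eval ballsT [])

  sepStep : ℕ → Val n set → Val n mat → Val n (bool ⊗ set ⊗ mat) → Val n (bool ⊗ set ⊗ mat)
  sepStep k A g s = eval (sepStepT k) (s ∷ A ∷ g ∷ [])

  sep : ℕ → Val n set → Val n mat → Val n (set ⊗ mat)
  sep k A g = eval (sepT k) (A ∷ g ∷ [])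

opaque
  unfolding growBallsT ballsT
  balls-layer : ∀ {n} (g : Val n mat) r c → lookup (balls g r) c ≡ layer g (singleton c) r
  balls-layer g zero    c = lookup∘tabulate singleton c
  balls-layer g (suc r) c = trans (lookup∘tabulate _ c) (cong (grow g) (balls-layer g r c))

Edge-balls : ∀ {n} {g : Val n mat} {r c u} → Edge (balls g r) c u ⇔ (∃[ ℓ ] (ℓ ≤ r × Path (Edge g) c u ℓ))
Edge-balls {g = g} {r} {c} {u} = mk⇔
  (λ e → let x , ℓ , hx , ℓ≤r , p = to (∈-layer g (singleton c) r)
               (subst (u ∈ˢ_) (balls-layer g r c) (target e))
         in ℓ , ℓ≤r , subst (λ x → Path (Edge g) x u ℓ) (to ∈-singleton hx) p)
  (λ (ℓ , ℓ≤r , p) → edge (subst (u ∈ˢ_) (sym (balls-layer g r c))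
    (from (∈-layer g (singleton c) r) (c , ℓ , from ∈-singleton refl , ℓ≤r , p))))

-- Stated for the matrices and not only for their members, because `Balanced` is computed from the
-- matrix itself.
balls-saturate : ∀ {n} (g : Val n mat) d → balls g (d + n) ≡ balls g n
balls-saturate {n} g d = begin
  balls g (d + n)                             ≡⟨ tabulate∘lookup _ ⟨
  tabulate (lookup (balls g (d + n)))         ≡⟨ tabulate-cong (λ c → trans (balls-layer g (d + n) c) (trans
                                                   (layer-saturates g (singleton c) d)
                                                       (sym (balls-layer g n c)))) ⟩
  tabulate (lookup (balls g n))               ≡⟨ tabulate∘lookup _ ⟩
  balls g n                                   ∎
  where open ≡-Reasoning

module _ {n : ℕ} (k : ℕ) (A : Val n set) (g : Val n mat) where
  Separates : ℕ → Val n (set ⊗ mat) → Set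
  Separates r s = ∃[ vs ] (s ≡ (insertAll {k = k} empty vs , balls g r) × Balanced A g (balls g r)
      (insertAll empty vs))

  opaque
    unfolding sepStepT decideT
    sepStep-done : ∀ {s} → Holds (proj₁ s) → sepStep k A g s ≡ s
    sepStep-done {true , _} h = refl

    sepStep-found : ∀ {b C r} → Holds (proj₁ (search k empty A g (balls g r))) →
                    Holds b ⊎ Holds (proj₁ (sepStep k A g (b , C , balls g r))) × Separates r
                        (proj₂ (sepStep k A g (b , C , balls g r)))
    sepStep-found {true}          h = inj₁ _
    sepStep-found {false} {r = r} h with search k empty A g (balls g r) in eq
    ... | true , C with search-sound k empty A g (balls g r) (subst (Holds ∘ proj₁) (sym eq) h)
    ...   | vs , e , b rewrite eq = inj₂ (h , vs , cong (_, balls g r) e , b)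

    sepStep-fail : ∀ {b C r} → ¬ Holds b → ¬ Holds (proj₁ (search k empty A g (balls g r))) →
                   ∃[ C′ ] sepStep k A g (b , C , balls g r) ≡ (false , C′ , balls g (suc r))
    sepStep-fail {true}          ¬b ¬h = ⊥-elim (¬b _)
    sepStep-fail {false} {r = r} ¬b ¬h with search k empty A g (balls g r)
    ... | true  , C = ⊥-elim (¬h _)
    ... | false , C = C , refl

  -- The invariant of the search over radii after `m` steps. As long as it fails the radius is `m`,
  -- and `m ≤ ρ` because the search cannot fail at `ρ`, a number the program does not know.
  Progress : ℕ → ℕ → Val n (bool ⊗ set ⊗ mat) → Set
  Progress ρ m s = (Holds (proj₁ s) × ∃[ r ] (r ≤ ρ × Separates r (proj₂ s))) ⊎
                   (m ≤ ρ × (∃[ C ] s ≡ (false , C , balls g m)))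

  module _ {ρ vs} (b : Balanced A g (balls g ρ) (insertAll {k = k} empty vs)) where
    sepStep-progress : ∀ {m s} → Progress ρ m s → Progress ρ (suc m) (sepStep k A g s)
    sepStep-progress {m} (inj₁ (h , good)) = subst (Progress ρ (suc m)) (sym (sepStep-done h))
        (inj₁ (h , good))
    sepStep-progress {m} (inj₂ (m≤ρ , C , refl)) with Holds? (proj₁ (search k empty A g (balls g m)))
    ... | yes h = [ (λ ()) , (λ (h′ , good) → inj₁ (h′ , m , m≤ρ , good)) ]′
        (sepStep-found {false} {C} {m} h)
    ... | no ¬h = inj₂ (≤∧≢⇒< m≤ρ (λ { refl → ¬h (search-complete k empty A g (balls g m) vs b) }) ,
        sepStep-fail {r = m} (λ ()) ¬h)

    progress : ∀ m → Progress ρ m (repeat m (λ _ → sepStep k A g) (false , empty , balls g 0))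
    progress zero    = inj₂ (z≤n , empty , refl)
    progress (suc m) = sepStep-progress (progress m)

    sepStep-separates : ∀ {s} → Progress ρ n s → ∃[ r ] (r ≤ ρ × Separates r (proj₂ (sepStep k A g s)))
    sepStep-separates (inj₁ (h , good)) =
      subst (λ s → ∃[ r ] (r ≤ ρ × Separates r (proj₂ s))) (sym (sepStep-done h)) good
    -- Here `ρ` is at least `n`, so the balls of radius `n` equal those of radius `ρ` and the last
    -- attempt succeeds.
    sepStep-separates (inj₂ (n≤ρ , C , refl)) with sepStep-found {false} {C} {n}
        (search-complete k empty A g (balls g n) vs
      (subst (λ B → Balanced A g B _) (trans (cong (balls g) (sym (m∸n+n≡m n≤ρ)))
          (balls-saturate g (ρ ∸ n))) b))
    ... | inj₂ (_ , good) = n , n≤ρ , good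

    opaque
      unfolding sepT
      sep-separates : ∃[ r ] (r ≤ ρ × Separates r (sep k A g))
      sep-separates = sepStep-separates (progress n)

-- Cycles in graphs, and the existence of a balanced bag

module _ {n : ℕ} {E : Fin n → Fin n → Set} where
  path? : (∀ u v → Dec (E u v)) → ∀ u v ℓ → Dec (Path E u v ℓ)
  path? E? u v zero    = map′ (λ { refl → [] }) (λ { [] → refl }) (u Fin.≟ v)
  path? E? u v (suc ℓ) = map′ (λ (w , e , p) → e ∷ p) (λ { (e ∷ p) → _ , e , p })
    (Fin.any? λ w → E? u w ×-dec path? E? w v ℓ)

  shortest : (∀ u v → Dec (E u v)) → ∀ {u v ℓ} → Path E u v ℓ →
             ∃[ d ] (Path E u v d × (∀ ℓ → Path E u v ℓ → d ≤ ℓ))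
  shortest E? {u} {v} {ℓ} p = least (Path E u v) (path? E? u v) ℓ p

  vertexAt : ∀ {u v ℓ} → Path E u v ℓ → Fin (suc ℓ) → Fin n
  vertexAt {u} p       zero    = u
  vertexAt     (e ∷ p) (suc i) = vertexAt p i

  vertexAt-step : ∀ {u v ℓ} (p : Path E u v ℓ) i → E (vertexAt p (inject₁ i)) (vertexAt p (suc i))
  vertexAt-step (e ∷ [])      zero    = e
  vertexAt-step (e ∷ (f ∷ p)) zero    = e
  vertexAt-step (e ∷ p)       (suc i) = vertexAt-step p i

  vertexAt-last : ∀ {u v ℓ} (p : Path E u v ℓ) → vertexAt p (fromℕ ℓ) ≡ v
  vertexAt-last []      = refl
  vertexAt-last (e ∷ p) = vertexAt-last p

  takeᴾ : ∀ {u v ℓ} (p : Path E u v ℓ) i → Path E u (vertexAt p i) (toℕ i)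
  takeᴾ p       zero    = []
  takeᴾ (e ∷ p) (suc i) = e ∷ takeᴾ p i

  dropᴾ : ∀ {u v ℓ} (p : Path E u v ℓ) i → Path E (vertexAt p i) v (ℓ ∸ toℕ i)
  dropᴾ p       zero    = p
  dropᴾ (e ∷ p) (suc i) = dropᴾ p i

  shortest-distinct : ∀ {u v d} (p : Path E u v d) → (∀ ℓ → Path E u v ℓ → d ≤ ℓ) →
                      ∀ {i j} → toℕ i < toℕ j → vertexAt p i ≢ vertexAt p j
  shortest-distinct {u} {v} {d} p min {i} {j} i<j eq = <⇒≱ shorter
    (min _ (takeᴾ p i ++ᴾ subst (λ w → Path E w v (d ∸ toℕ j)) (sym eq) (dropᴾ p j)))
    where
    shorter : toℕ i + (d ∸ toℕ j) < d
    shorter = begin-strict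
      toℕ i + (d ∸ toℕ j)  <⟨ +-monoˡ-< (d ∸ toℕ j) i<j ⟩
      toℕ j + (d ∸ toℕ j)  ≡⟨ m+[n∸m]≡n (s≤s⁻¹ (Fin.toℕ<n j)) ⟩
      d                    ∎
      where open ≤-Reasoning

distinct⇒injective : ∀ {m n} (f : Fin m → Fin n) → (∀ {i j} → toℕ i < toℕ j → f i ≢ f j) →
                     ∀ {i j} → f i ≡ f j → i ≡ j
distinct⇒injective f distinct {i} {j} eq with <-cmp (toℕ i) (toℕ j)
... | tri< i<j _ _ = ⊥-elim (distinct i<j eq)
... | tri≈ _ i≡j _ = Fin.toℕ-injective i≡j
... | tri> _ _ j<i = ⊥-elim (distinct j<i (sym eq))

module _ {n : ℕ} (T : Graph n) where
  AvoidingEdge : Fin n → Fin n → Fin n → Fin n → Set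
  AvoidingEdge i j x y = Adj T x y × ¬ (x ≡ i × y ≡ j) × ¬ (x ≡ j × y ≡ i)

  avoidingEdge? : ∀ i j x y → Dec (AvoidingEdge i j x y)
  avoidingEdge? i j x y = T? (adj T x y) ×-dec (¬? ((x Fin.≟ i) ×-dec (y Fin.≟ j)) ×-dec ¬?
      ((x Fin.≟ j) ×-dec (y Fin.≟ i)))

  -- A shortest bypass has distinct vertices, and the edge from `i` to `j` closes it. Length 0 would
  -- make that edge a loop; length 1 would use the edge itself.
  bypass⇒cycle : ∀ {i j ℓ} → Adj T i j → Path (AvoidingEdge i j) j i ℓ → Cycle T
  bypass⇒cycle {i} {j} e p with shortest (avoidingEdge? i j) p
  ... | 0 , [] , _ = ⊥-elim (Graph.irrefl T e)
  ... | 1 , (_ , _ , ¬e) ∷ [] , _ = ⊥-elim (¬e (refl , refl))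
  ... | suc (suc m) , q , min = record
    { extra    = m
    ; vertex   = vertexAt q
    ; distinct = distinct⇒injective (vertexAt q) (shortest-distinct q min)
    ; step     = λ k → proj₁ (vertexAt-step q k)
    ; close    = subst (λ x → Adj T x j) (sym (vertexAt-last q)) e
    }

  iterate : (Fin n → Fin n) → ℕ → Fin n → Fin n
  iterate f zero    x = x
  iterate f (suc m) x = f (iterate f m x)

  iterate-+ : ∀ f k m x → iterate f (k + m) x ≡ iterate f k (iterate f m x)
  iterate-+ f zero    m x = refl
  iterate-+ f (suc k) m x = cong f (iterate-+ f k m x)

  -- The least period of a periodic point is the length of a cycle.
  orbit⇒cycle : (f : Fin n → Fin n) → (∀ x → Adj T x (f x)) → (∀ x → f (f x) ≢ x) → Fin n → Cycle T
  orbit⇒cycle f arc turn x₀ with Fin.pigeonhole (n<1+n n) (λ i → iterate f (toℕ i) x₀)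
  ... | i , j , i<j , eq with least (λ p → 1 ≤ p × iterate f p y ≡ y)
      (λ p → (1 ≤? p) ×-dec (iterate f p y Fin.≟ y)) (toℕ j ∸ toℕ i)
                                (m<n⇒0<n∸m i<j , trans (sym (iterate-+ f (toℕ j ∸ toℕ i) (toℕ i) x₀))
                                  (trans (cong (λ m → iterate f m x₀) (m∸n+n≡m (<⇒≤ i<j))) (sym eq)))
    where y = iterate f (toℕ i) x₀
  ... | suc zero , (_ , fix) , _ = ⊥-elim (Graph.irrefl T (subst (Adj T _) fix (arc _)))
  ... | suc (suc zero) , (_ , fix) , _ = ⊥-elim (turn _ fix)
  ... | suc (suc (suc m)) , (_ , fix) , min = record
    { extra    = m
    ; vertex   = λ k → iterate f (toℕ k) y
    ; distinct = distinct⇒injective (λ k → iterate f (toℕ k) y) distinct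
    ; step     = λ k → subst (λ m → Adj T (iterate f m y) (f (iterate f (toℕ k) y)))
        (sym (Fin.toℕ-inject₁ k)) (arc _)
    ; close    = subst (λ m → Adj T (iterate f m y) y) (sym (Fin.toℕ-fromℕ (2 + m)))
        (subst (Adj T _) fix (arc _))
    }
    where
    y = iterate f (toℕ i) x₀
    distinct : ∀ {a b : Fin (3 + m)} → toℕ a < toℕ b → iterate f (toℕ a) y ≢ iterate f (toℕ b) y
    -- Were the points at `a` and `b` equal, cutting out the stretch between them would leave a
    -- shorter positive period.
    distinct {a} {b} a<b eq = <⇒≱ shorter (min (3 + m ∸ toℕ b + toℕ a)
        (≤-trans (m<n⇒0<n∸m (Fin.toℕ<n b)) (m≤m+n _ (toℕ a)) , (begin
      iterate f (3 + m ∸ toℕ b + toℕ a) y            ≡⟨ iterate-+ f (3 + m ∸ toℕ b) (toℕ a) y ⟩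
      iterate f (3 + m ∸ toℕ b) (iterate f (toℕ a) y) ≡⟨ cong (iterate f (3 + m ∸ toℕ b)) eq ⟩
      iterate f (3 + m ∸ toℕ b) (iterate f (toℕ b) y) ≡⟨ iterate-+ f (3 + m ∸ toℕ b) (toℕ b) y ⟨
      iterate f (3 + m ∸ toℕ b + toℕ b) y
          ≡⟨ cong (λ p → iterate f p y) (m∸n+n≡m (<⇒≤ (Fin.toℕ<n b))) ⟩
      iterate f (3 + m) y                             ≡⟨ fix ⟩
      y                                               ∎)))
      where
      open ≡-Reasoning
      shorter : 3 + m ∸ toℕ b + toℕ a < 3 + m
      shorter = <-≤-trans (+-monoʳ-< (3 + m ∸ toℕ b) a<b) (≤-reflexive (m∸n+n≡m (<⇒≤ (Fin.toℕ<n b))))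

-- Components left after a deletion

module _ {n : ℕ} where
  mask : Val n set → Val n mat → Val n mat
  mask A g = eval maskT (A ∷ g ∷ [])

  cover : Val n set → Val n mat → Val n set
  cover C B = eval coverT (C ∷ B ∷ [])

  diff : Val n set → Val n set → Val n set
  diff A D = eval diffT (A ∷ D ∷ [])

  component : Val n set → Val n mat → Fin n → Val n set
  component R g a = reach (mask R g) (singleton a)

  ∈-component : ∀ {R g a u} → u ∈ˢ component R g a ⇔ (∃[ ℓ ] Path (Edge (mask R g)) a u ℓ)
  ∈-component {R} {g} {a} {u} = mk⇔
    (λ h → let x , ℓ , hx , p = to ∈-reach h in ℓ ,
                 subst (λ x → Path (Edge (mask R g)) x u ℓ) (to ∈-singleton hx) p)
    (λ (ℓ , p) → from ∈-reach (a , ℓ , from ∈-singleton refl , p))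

  mask-end : ∀ {R g a u ℓ} → a ∈ˢ R → Path (Edge (mask R g)) a u ℓ → u ∈ˢ R
  mask-end h []      = h
  mask-end h (e ∷ p) = mask-end (proj₂ (proj₁ (to Edge-mask e))) p

  component⊆ : ∀ {R g a} → a ∈ˢ R → component R g a ⊆ˢ R
  component⊆ h h′ = mask-end h (proj₂ (to ∈-component h′))

  balanced⇔ : ∀ {A g B C} → let R = diff A (cover C B) in
              Balanced A g B C ⇔ (∀ {a} → a ∈ˢ R → 2 * size (component R g a) ≤ size A)
  balanced⇔ = mk⇔
    (λ b {a} h → decidable-stable (_ ≤? _) λ l → to ⊨balanced b (a , h , l))
    (λ f → from ⊨balanced λ (a , h , l) → l (f h))

  majorities-meet : ∀ {A X Y : Val n set} → X ⊆ˢ A → Y ⊆ˢ A → size A < 2 * size X → size A < 2 * size Y →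
                    ∃[ v ] (v ∈ˢ X × v ∈ˢ Y)
  majorities-meet {A} {X} {Y} X⊆A Y⊆A hX hY = decidable-stable
      (Fin.any? λ v → (v ∈ˢ? X) ×-dec (v ∈ˢ? Y)) λ disjoint →
    <⇒≱ (+-mono-< hX hY) (begin
      2 * size X + 2 * size Y                           ≡⟨ *-distribˡ-+ 2 (size X) (size Y) ⟨
      2 * (size X + size Y)
          ≡⟨ cong (2 *_) (∑-distrib-+ (bit ∘ lookup X) (bit ∘ lookup Y)) ⟨
      2 * sum (λ i → bit (lookup X i) + bit (lookup Y i))
          ≤⟨ *-monoʳ-≤ 2 (sum-mono λ i → bits (lookup X i) (lookup Y i) (lookup A i)
                                                             (λ h → member (X⊆A (mem h)))
                                                                 (λ h → member (Y⊆A (mem h)))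
                                                             (λ h h′ → disjoint (i , mem h , mem h′))) ⟩
      2 * size A                                        ≡⟨ cong (size A +_) (+-identityʳ (size A)) ⟩
      size A + size A                                   ∎)
    where
    open ≤-Reasoning
    bits : ∀ x y a → (Holds x → Holds a) → (Holds y → Holds a) → (Holds x → ¬ Holds y) →
        bit x + bit y ≤ bit a
    bits true  true  a p q r = ⊥-elim (r _ _)
    bits true  false a p q r = bit-mono {true} {a} p
    bits false y     a p q r = bit-mono {y} {a} q

Edge-adjacency : ∀ {n} {G : Graph n} {u v} → Edge (adjacency G) u v ⇔ Adj G u v
Edge-adjacency {G = G} {u} {v} = mk⇔
  (λ e → subst T (sym (adjacency-adj G u v)) (true! (member (target e))))
  (λ e → edge (mem (holds (subst T (adjacency-adj G u v) e))))

-- Were no bag a balanced separator, each node i of the tree would have a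
-- neighbour f i on the side of the majority component left by its bag.  Any
-- two majorities meet, so f never turns back, and iterating f closes a cycle.
module BalancedBag {n} {G S : Graph n} (S⊆G : S ⊆ᴳ G) (D : TreeDecomposition S) {t ρ : ℕ} (t≤2ρ : t ≤ ρ + ρ)
  (spans : ∀ {u v} → Adj G u v → ∃[ ℓ ] (ℓ ≤ t × Path (Adj S) u v ℓ))
  (C : Fin (TreeDecomposition.size D) → Val n set)
  (bag⊆C : ∀ {i v} → v ∈ᵇ TreeDecomposition.bag D i → v ∈ˢ C i)
  (A : Val n set) where

  open TreeDecomposition D using (tree; isTree; bag; coversVertices; coversEdges; coherent)

  g : Val n mat
  g = adjacency G

  Rest : Fin (TreeDecomposition.size D) → Val n set
  Rest i = diff A (cover (C i) (balls g ρ))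

  -- This is the tree without node `i`. For nodes other than `i`, `Star (Avoiding i) x y` says that
  -- `x` and `y` lie on the same side of `i`.
  Avoiding : Fin (TreeDecomposition.size D) → Fin (TreeDecomposition.size D) →
      Fin (TreeDecomposition.size D) → Set
  Avoiding i x y = Adj tree x y × x ≢ i × y ≢ i

  avoiding-sym : ∀ {i x y} → Avoiding i x y → Avoiding i y x
  avoiding-sym (e , x≢i , y≢i) = Graph.sym tree e , y≢i , x≢i

  sameVertex : ∀ {i v x y} → ¬ v ∈ᵇ bag i → v ∈ᵇ bag x → v ∈ᵇ bag y → Star (Avoiding i) x y
  sameVertex {v = v} v∉i v∈x v∈y = Star.map
    (λ (e , hx , hy) → e , (λ { refl → v∉i hx }) , (λ { refl → v∉i hy })) (coherent v _ _ v∈x v∈y)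

  rest-far : ∀ {i u b ℓ} → u ∈ˢ Rest i → b ∈ᵇ bag i → Path (Adj S) b u ℓ → ¬ ℓ ≤ ρ
  rest-far h hb p ℓ≤ρ = proj₂ (to ∈-diff h) (from ∈-cover (_ , bag⊆C hb ,
    from Edge-balls (_ , ℓ≤ρ , mapᴾ (λ e → from (Edge-adjacency {G = G}) (S⊆G _ _ e)) p)))

  rest∉bag : ∀ {i u} → u ∈ˢ Rest i → ¬ u ∈ᵇ bag i
  rest∉bag h hb = rest-far h hb [] z≤n

  -- If `s` were in the bag, both survivors `u` and `v` would be farther than `ρ` from it along the
  -- path, whose length would then exceed `ρ + ρ` and so `t`.
  detour∉bag : ∀ {i u s v k ℓ} → u ∈ˢ Rest i → v ∈ˢ Rest i → Path (Adj S) u s k → Path (Adj S) s v ℓ →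
      k + ℓ ≤ t →
               ¬ s ∈ᵇ bag i
  detour∉bag {k = k} {ℓ} hu hv p q k+ℓ≤t hs with k ≤? ρ | ℓ ≤? ρ
  ... | yes k≤ρ | _       = rest-far hu hs (reverseᴾ (Graph.sym S) p) k≤ρ
  ... | no  _   | yes ℓ≤ρ = rest-far hv hs q ℓ≤ρ
  ... | no  k≰ρ | no ℓ≰ρ  = <⇒≱ (+-mono-< (≰⇒> k≰ρ) (≰⇒> ℓ≰ρ)) (≤-trans k+ℓ≤t t≤2ρ)

  -- Consecutive vertices of the path share a bag, a node common to their two subtrees. As no vertex
  -- of the path is in bag `i`, all these subtrees lie on one side of `i`.
  detour-side : ∀ {i u s v k ℓ x y} → u ∈ˢ Rest i → v ∈ˢ Rest i → Path (Adj S) u s k →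
      Path (Adj S) s v ℓ → k + ℓ ≤ t →
                s ∈ᵇ bag x → v ∈ᵇ bag y → Star (Avoiding i) x y
  detour-side hu hv p [] _ hx hy = sameVertex (rest∉bag hv) hx hy
  detour-side {k = k} {suc ℓ} hu hv p (e ∷ q) l hx hy with coversEdges _ _ e
  ... | z , hz , hz′ =
    sameVertex (detour∉bag hu hv p (e ∷ q) l) hx hz ◅◅
    detour-side hu hv (p ∷ʳᴾ e) q (subst (_≤ t) (+-suc k ℓ) l) hz′ hy

  -- Each edge of `G` within `Rest i` is replaced by a path of `S`, which may leave `Rest i` but
  -- still misses bag `i`.
  component-side : ∀ {i u v ℓ x y} → u ∈ˢ Rest i → Path (Edge (mask (Rest i) g)) u v ℓ →
                   u ∈ᵇ bag x → v ∈ᵇ bag y → Star (Avoiding i) x y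
  component-side hu [] hx hy = sameVertex (rest∉bag hu) hx hy
  component-side hu (_∷_ {v = w} e p) hx hy with to Edge-mask e
  ... | (_ , hw) , e′ with spans (to (Edge-adjacency {G = G}) e′) | coversVertices w
  ...   | ℓ , ℓ≤t , q | z , hz = detour-side hu hw [] q ℓ≤t hx hz ◅◅ component-side hw p hz hy

  -- The walk is cut where it first enters `i`; the node before is the neighbour of `i` on the side
  -- of `x`.
  exit : ∀ {i x ℓ} → Walk tree x i ℓ → x ≢ i → ∃[ j ] (Adj tree i j × Star (Avoiding i) x j)
  exit [] x≢i = ⊥-elim (x≢i refl)
  exit {i} (_∷_ {v = y} e p) x≢i with y Fin.≟ i
  ... | yes refl = _ , Graph.sym tree e , ε
  ... | no y≢i with exit p y≢i
  ...   | j , f , q = j , f , (e , x≢i , y≢i) ◅ q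

  star⇒path : ∀ {V : Set} {E : V → V → Set} {u v} → Star E u v → ∃[ ℓ ] Path E u v ℓ
  star⇒path ε = 0 , []
  star⇒path (e ◅ p) with star⇒path p
  ... | ℓ , q = suc ℓ , e ∷ q

  module Unbalanced (bad : ∀ i → ∃[ a ] (a ∈ˢ Rest i × size A < 2 * size (component (Rest i) g a))) where
    majority : Fin (TreeDecomposition.size D) → Val n set
    majority i = component (Rest i) g (proj₁ (bad i))

    home : Fin (TreeDecomposition.size D) → Fin (TreeDecomposition.size D)
    home i = proj₁ (coversVertices (proj₁ (bad i)))

    towards : ∀ i → ∃[ j ] (Adj tree i j × Star (Avoiding i) (home i) j)
    towards i = exit (proj₂ (Connected.joined (IsTree.connected isTree) (home i) i)) λ eq →
      rest∉bag (proj₁ (proj₂ (bad i))) (subst (λ j → proj₁ (bad i) ∈ᵇ bag j) eq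
          (proj₂ (coversVertices (proj₁ (bad i)))))

    next : Fin (TreeDecomposition.size D) → Fin (TreeDecomposition.size D)
    next i = proj₁ (towards i)

    majority-side : ∀ {i v y} → v ∈ˢ majority i → v ∈ᵇ bag y → Star (Avoiding i) y (next i)
    majority-side {i} h hy =
      Star.reverse avoiding-sym (component-side (proj₁ (proj₂ (bad i))) (proj₂ (to ∈-component h))
          (proj₂ (coversVertices (proj₁ (bad i)))) hy)
      ◅◅ proj₂ (proj₂ (towards i))

    majority⊆A : ∀ {i} → majority i ⊆ˢ A
    majority⊆A {i} h = proj₁ (to ∈-diff (component⊆ (proj₁ (proj₂ (bad i))) h))

    -- Suppose `next` leads from `i` to `j` and back. A node whose bag holds a common vertex of the
    -- two majorities reaches `j` without passing `i`, and `i` without passing `j`. Together these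
    -- walks bypass the edge between `i` and `j`, which closes a cycle.
    noTurn : ∀ i → next (next i) ≢ i
    noTurn i eq with majorities-meet (majority⊆A {i}) (majority⊆A {next i}) (proj₂ (proj₂ (bad i)))
        (proj₂ (proj₂ (bad (next i))))
    ... | v , h , h′ with coversVertices v
    ...   | y , hy = IsTree.acyclic isTree (bypass⇒cycle tree (proj₁ (proj₂ (towards i))) (proj₂ (star⇒path
      (Star.map (λ (e , x≢i , y≢i) → e , x≢i ∘ proj₁ , y≢i ∘ proj₂)
         (Star.reverse avoiding-sym (majority-side h hy)) ◅◅
       Star.map (λ (e , x≢j , y≢j) → e , y≢j ∘ proj₂ , x≢j ∘ proj₁)
         (subst (Star (Avoiding (next i)) y) eq (majority-side h′ hy))))))

    impossible : Fin n → ⊥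
    impossible v = IsTree.acyclic isTree
      (orbit⇒cycle tree next (λ i → proj₁ (proj₂ (towards i))) noTurn (proj₁ (coversVertices v)))

  -- Balance is decidable and there are finitely many bags, so refuting its failure yields a bag.
  -- The vertex `v` supplies the node at which the orbit of `next` starts.
  bag-balanced : Fin n → ∃[ i ] Balanced A g (balls g ρ) (C i)
  bag-balanced v = decidable-stable (Fin.any? λ i → Holds? _) λ none → Unbalanced.impossible
    (λ i → decidable-stable (Fin.any? λ a → (a ∈ˢ? Rest i) ×-dec (_ <? _)) λ unbad →
      none (i , from balanced⇔ λ {a} h → ≮⇒≥ λ l → unbad (a , h , l))) v

-- The recursion and its stretch

module _ {n : ℕ} where
  inter : Val n set → Val n set → Val n set
  inter A D = eval interT (A ∷ D ∷ [])

  separator : ℕ → Val n set → Val n mat → Val n set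
  separator k A g = cover (proj₁ (sep k A g)) (proj₂ (sep k A g))

  parents : Val n set → Val n (set ⊗ mat) → Val n mat → Fin n → Val n set
  parents A s K u = eval parentsT (A ∷ s ∷ K ∷ u ∷ [])

  links : ℕ → Val n set → Val n mat → Fin n → Val n set
  links k A g u = parents A (sep k A g) (mask A g) u

  full : Val n set
  full = eval fullT []

  level : ℕ → Val n mat → Val n (set ⊗ mat) → Val n (set ⊗ mat)
  level k g s = eval (levelT k) (s ∷ g ∷ [])

  levels : ℕ → Val n mat → ℕ → Val n (set ⊗ mat)
  levels k g ℓ = repeat ℓ (λ _ → level k g) (full , noEdges)

  spanner : ℕ → Val n mat → Val n mat
  spanner k g = eval (spannerT k) (g ∷ [])

opaque
  unfolding parentsT
  ∈-parents : ∀ {n} {A} {s : Val n (set ⊗ mat)} {K u w} → w ∈ˢ parents A s K u ⇔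
    (∃[ c ] (c ∈ˢ proj₁ s × (Edge (forest (inter A (lookup (proj₂ s) c)) K) u w ⊎ Edge
        (forest (inter A (singleton c)) K) u w)))
  ∈-parents = ⊨table (⊨any λ _ → ⊨and ⊨∈ (⊨or ⊨Edge ⊨Edge))

opaque
  unfolding levelT separatorT linksT pieceT
  ∈-level : ∀ {n k g} {s : Val n (set ⊗ mat)} {u} → u ∈ˢ proj₁ (level k g s) ⇔
            (u ∈ˢ proj₁ s × ¬ u ∈ˢ separator k (component (proj₁ s) g u) g)
  ∈-level = ⊨table (⊨and ⊨∈ (⊨neg ⊨∈))

  Edge-level : ∀ {n k g} {s : Val n (set ⊗ mat)} {u w} → Edge (proj₂ (level k g s)) u w ⇔
               (Edge (proj₂ s) u w ⊎ (u ∈ˢ proj₁ s × w ∈ˢ links k (component (proj₁ s) g u) g u))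
  Edge-level = ⊨row (⊨table (⊨or ⊨Edge (⊨and ⊨∈ ⊨∈)))

opaque
  unfolding spannerT symmetriseT
  Edge-spanner : ∀ {n k} {g : Val n mat} {u w} → Edge (spanner k g) u w ⇔
                 (Edge (proj₂ (levels k g n)) u w ⊎ Edge (proj₂ (levels k g n)) w u)
  Edge-spanner = ⊨row (⊨table (⊨or ⊨Edge ⊨Edge))

⊆ˢ-antisym : ∀ {n} {X Y : Val n set} → X ⊆ˢ Y → Y ⊆ˢ X → X ≡ Y
⊆ˢ-antisym {X = X} {Y} p q with ⊆ˢ⇒≡⊎< X Y (λ i h → member (p (mem h))) refl
... | inj₁ eq = eq
... | inj₂ l  = ⊥-elim (<⇒≱ l (size-mono {X = Y} {X} q))

module Recursion {n} (G : Graph n) (k ρ : ℕ)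
  (good : ∀ A → ∃[ r ] (r ≤ ρ × Separates k A (adjacency G) r (sep k A (adjacency G)))) where

  g : Val n mat
  g = adjacency G

  Rem : ℕ → Val n set
  Rem ℓ = proj₁ (levels k g ℓ)

  Link : ℕ → Val n mat
  Link ℓ = proj₂ (levels k g ℓ)

  piece : ℕ → Fin n → Val n set
  piece ℓ u = component (Rem ℓ) g u

  mask-sym : ∀ {R u v} → Edge (mask R g) u v → Edge (mask R g) v u
  mask-sym e with to Edge-mask e
  ... | (hu , hv) , e′ = from Edge-mask ((hv , hu) ,
      from (Edge-adjacency {G = G}) (Graph.sym G (to (Edge-adjacency {G = G}) e′)))

  -- Equality of the vectors themselves makes the separators and forests computed at different
  -- vertices of one piece identical.
  component-≡ : ∀ {R u v ℓ} → Path (Edge (mask R g)) u v ℓ → component R g u ≡ component R g v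
  component-≡ p = ⊆ˢ-antisym
    (λ h → from ∈-component (_ , reverseᴾ mask-sym p ++ᴾ proj₂ (to ∈-component h)))
    (λ h → from ∈-component (_ , p ++ᴾ proj₂ (to ∈-component h)))

  Rem-suc⊆ : ∀ ℓ → Rem (suc ℓ) ⊆ˢ Rem ℓ
  Rem-suc⊆ ℓ h = proj₁ (to ∈-level h)

  rest : ℕ → Fin n → Val n set
  rest ℓ u = diff (piece ℓ u) (separator k (piece ℓ u) g)

  -- All vertices met have the same piece as `u`. Each survivor of level `ℓ` lies outside the
  -- separator of its own piece, which is therefore that of `u`.
  path-in-rest : ∀ ℓ {u v w m i} → Path (Edge (mask (Rem ℓ) g)) u v m →
      Path (Edge (mask (Rem (suc ℓ)) g)) v w i →
                 Path (Edge (mask (rest ℓ u) g)) v w i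
  path-in-rest ℓ p [] = []
  path-in-rest ℓ {u} p (e ∷ q) with to Edge-mask e
  ... | (hv , hw) , e′ = from Edge-mask ((inRest p hv , inRest p′ hw) , e′) ∷ path-in-rest ℓ p′ q
    where
    p′ : Path (Edge (mask (Rem ℓ) g)) u _ _
    p′ = p ∷ʳᴾ from Edge-mask ((Rem-suc⊆ ℓ hv , Rem-suc⊆ ℓ hw) , e′)
    inRest : ∀ {v m} → Path (Edge (mask (Rem ℓ) g)) u v m → v ∈ˢ Rem (suc ℓ) → v ∈ˢ rest ℓ u
    inRest {v} p h = from ∈-diff (from ∈-component (_ , p) , λ hs →
      proj₂ (to ∈-level h) (subst (λ A → v ∈ˢ separator k A g) (component-≡ p) hs))

  piece-halves : ∀ ℓ {u} → u ∈ˢ Rem (suc ℓ) → 2 * size (piece (suc ℓ) u) ≤ size (piece ℓ u)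
  piece-halves ℓ {u} h with good (piece ℓ u)
  ... | r , _ , vs , eq , balanced = ≤-trans
    (*-monoʳ-≤ 2 (size-mono {X = piece (suc ℓ) u} {component (rest ℓ u) g u}
      (λ h′ → from ∈-component (_ , path-in-rest ℓ [] (proj₂ (to ∈-component h′))))))
    (to balanced⇔ (subst (λ s → Balanced (piece ℓ u) g (proj₂ s) (proj₁ s)) (sym eq) balanced)
      (from ∈-diff (from ∈-component (0 , []) , proj₂ (to ∈-level h))))

  2^ℓ*piece≤n : ∀ ℓ {u} → u ∈ˢ Rem ℓ → 2 ^ ℓ * size (piece ℓ u) ≤ n
  2^ℓ*piece≤n zero    {u} h = ≤-trans (≤-reflexive (*-identityˡ (size (piece 0 u))))
      (count≤n (lookup (piece 0 u)))
  2^ℓ*piece≤n (suc ℓ) {u} h = begin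
    2 * 2 ^ ℓ * size (piece (suc ℓ) u)      ≡⟨ cong (_* size (piece (suc ℓ) u)) (*-comm 2 (2 ^ ℓ)) ⟩
    2 ^ ℓ * 2 * size (piece (suc ℓ) u)      ≡⟨ *-assoc (2 ^ ℓ) 2 _ ⟩
    2 ^ ℓ * (2 * size (piece (suc ℓ) u))    ≤⟨ *-monoʳ-≤ (2 ^ ℓ) (piece-halves ℓ h) ⟩
    2 ^ ℓ * size (piece ℓ u)                ≤⟨ 2^ℓ*piece≤n ℓ (Rem-suc⊆ ℓ h) ⟩
    n                                       ∎
    where open ≤-Reasoning

  Rem-empty : ∀ ℓ {u} → n < 2 ^ ℓ → ¬ u ∈ˢ Rem ℓ
  Rem-empty ℓ {u} l h = <⇒≱ l (≤-trans (≤-trans (≤-reflexive (sym (*-identityʳ (2 ^ ℓ))))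
    (*-monoʳ-≤ (2 ^ ℓ) (size≥1 {X = piece ℓ u} (from ∈-component (0 , []))))) (2^ℓ*piece≤n ℓ h))

  -- Replacement walks and their surplus

  Linked : Fin n → Fin n → Set
  Linked = Edge (spanner k g)

  linked-sym : ∀ {u v} → Linked u v → Linked v u
  linked-sym e = from Edge-spanner ([ inj₂ , inj₁ ]′ (to Edge-spanner e))

  link-mono : ∀ {ℓ m u v} → ℓ ≤′ m → Edge (Link ℓ) u v → Edge (Link m) u v
  link-mono ≤′-refl     e = e
  link-mono (≤′-step l) e = from Edge-level (inj₁ (link-mono l e))

  link⇒adj : ∀ ℓ {u v} → Edge (Link ℓ) u v → Adj G u v
  link⇒adj zero    e = ⊥-elim (∉-empty (to (⊨row ⇔-id) e))
  link⇒adj (suc ℓ) e with to Edge-level e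
  ... | inj₁ e′      = link⇒adj ℓ e′
  ... | inj₂ (_ , h) = Graph.sym G (to (Edge-adjacency {G = G}) (proj₂ (to Edge-mask
    ([ forest-edge , forest-edge ]′ (proj₂ (proj₂ (to ∈-parents h)))))))

  linked⇒adj : ∀ {u v} → Linked u v → Adj G u v
  linked⇒adj e = [ link⇒adj n , Graph.sym G ∘ link⇒adj n ]′ (to Edge-spanner e)

  -- The link is stored by the child `u` when it treats its own piece, which is that of `p`. The
  -- bound `ℓ < n` ensures that this level is run.
  forest⇒linked : ∀ ℓ {p X} → ℓ < n →
    (∀ {u w} → Edge (forest X (mask (piece ℓ p) g)) u w → w ∈ˢ links k (piece ℓ p) g u) →
    p ∈ˢ Rem ℓ → ∀ {u w} → Edge (forest X (mask (piece ℓ p) g)) u w → Linked u w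
  forest⇒linked ℓ {p} ℓ<n f hp {u} {w} e = from Edge-spanner
      (inj₁ (link-mono (≤⇒≤′ ℓ<n) (from Edge-level (inj₂
    (component⊆ {R = Rem ℓ} hp hu , subst (λ A → w ∈ˢ links k A g u)
        (component-≡ (proj₂ (to ∈-component hu))) (f e))))))
    where
    hu : u ∈ˢ piece ℓ p
    hu = proj₂ (proj₁ (to Edge-mask (forest-edge e)))

  path-in-piece : ∀ ℓ {p u v m i} → Path (Edge (mask (Rem ℓ) g)) p u m →
      Path (Edge (mask (Rem ℓ) g)) u v i →
                  Path (Edge (mask (piece ℓ p) g)) u v i
  path-in-piece ℓ q [] = []
  path-in-piece ℓ q (e ∷ p) = from Edge-mask ((from ∈-component (_ , q) ,
      from ∈-component (_ , q ∷ʳᴾ e)) , proj₂ (to Edge-mask e))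
                            ∷ path-in-piece ℓ (q ∷ʳᴾ e) p

  stays⊎leaves : ∀ R {x y i} → Path (Adj G) x y i →
    (x ∈ˢ R × Path (Edge (mask R g)) x y i) ⊎
    (∃[ p ] ∃[ a ] ∃[ b ] (¬ p ∈ˢ R × Path (Adj G) x p a × Path (Adj G) p y b × a + b ≡ i))
  stays⊎leaves R {x} p with x ∈ˢ? R
  stays⊎leaves R p       | no ¬h = inj₂ (_ , 0 , _ , ¬h , [] , p , refl)
  stays⊎leaves R []      | yes h = inj₁ (h , [])
  stays⊎leaves R (e ∷ p) | yes h with stays⊎leaves R p
  ... | inj₁ (h′ , q) = inj₁ (h , from Edge-mask ((h , h′) , from (Edge-adjacency {G = G}) e) ∷ q)
  ... | inj₂ (v , a , b , ¬h , q , r , refl) = inj₂ (v , suc a , b , ¬h , e ∷ q , r , refl)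

  -- A walk through a vertex `p` deleted before level `ℓ` pays at most `ρ + ρ` per level. It is
  -- given in two parts so that an earlier deleted vertex can take the place of `p`.
  Detour : ℕ → Set
  Detour ℓ = ∀ {x p y i j} → ¬ p ∈ˢ Rem ℓ → Path (Adj G) x p i → Path (Adj G) p y j →
             ∃[ d ] (d ≤ i + j + ℓ * (ρ + ρ) × Path Linked x y d)

  module Crossing (ℓ : ℕ) (ℓ<n : ℓ < n) (ih : Detour ℓ) {p c : Fin n} (p∈R : p ∈ˢ Rem ℓ)
    (c∈C : c ∈ˢ proj₁ (sep k (piece ℓ p) g)) (p∈B : Edge (proj₂ (sep k (piece ℓ p) g)) c p) where

    A X : Val n set
    A = piece ℓ p
    X = inter A (lookup (proj₂ (sep k (piece ℓ p) g)) c)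

    -- The first stretch of a replacement walk: from `u` down the forest to a vertex `u′` of the
    -- ball. Balls are taken in `G`, so the path from `c` to `u′` may leave the piece, and `c` may
    -- lie outside it.
    Hop : Fin n → ℕ → Set
    Hop u i = ∃[ u′ ] ∃[ a ] (a ≤ i × Path Linked u u′ a × u′ ∈ˢ A × (∃[ m ] (m ≤ ρ × Path (Adj G) c u′ m)))

    hop : ∀ {u i} → Path (Edge (mask (Rem ℓ) g)) p u i → Hop u i
    -- Since `p` is a root of this forest, the walk from `p` to `u` bounds the length of the forest
    -- path from `u`.
    hop q with forest-path {X = X} (from ∈-inter (from ∈-component (0 , []) , target p∈B))
        (path-in-piece ℓ [] q)
    ... | u′ , a , hu′ , a≤i , F = u′ , a , a≤i ,
      mapᴾ (forest⇒linked ℓ ℓ<n (λ e → from ∈-parents (c , c∈C , inj₁ e)) p∈R) F ,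
          proj₁ (to ∈-inter hu′) , near
      where
      near : ∃[ m ] (m ≤ ρ × Path (Adj G) c u′ m)
      near with good (piece ℓ p)
      ... | r , r≤ρ , vs , eq , _ with to Edge-balls
          (edge (subst (λ s → u′ ∈ˢ lookup (proj₂ s) c) eq (proj₂ (to ∈-inter hu′))))
      ...   | m , m≤r , q = m , ≤-trans m≤r r≤ρ , mapᴾ (to (Edge-adjacency {G = G})) q

    -- A walk of length at most 2ρ through the centre either stays in the
    -- piece, where the tree grown from the centre serves, or meets an
    -- earlier separator.
    across : ∀ {x y i j} (h : Hop x i) (h′ : Hop y j) →
             ∃[ d ] (d ≤ ρ + ρ + ℓ * (ρ + ρ) × Path Linked (proj₁ h) (proj₁ h′) d)
    across (x′ , _ , _ , _ , hx′ , m , m≤ρ , M) (y′ , _ , _ , _ , hy′ , m′ , m′≤ρ , M′)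
      with stays⊎leaves (Rem ℓ) M | stays⊎leaves (Rem ℓ) M′
    ... | inj₂ (q , a , b , hq , M₁ , M₂ , refl) | _ =
      let d , d≤ , D = ih hq (reverseᴾ (Graph.sym G) M₂) (reverseᴾ (Graph.sym G) M₁ ++ᴾ M′)
      in d , ≤-trans d≤ (+-monoˡ-≤ _ (≤-trans (≤-reflexive
          (trans (sym (+-assoc b a m′)) (cong (_+ m′) (+-comm b a)))) (+-mono-≤ m≤ρ m′≤ρ))) , D
    ... | inj₁ _ | inj₂ (q , a , b , hq , M₁ , M₂ , refl) =
      let d , d≤ , D = ih hq (reverseᴾ (Graph.sym G) M ++ᴾ M₁) M₂
      in d , ≤-trans d≤ (+-monoˡ-≤ _ (≤-trans (≤-reflexive (+-assoc m a b)) (+-mono-≤ m≤ρ m′≤ρ))) , D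
    ... | inj₁ (_ , N) | inj₁ (_ , N′) =
      let a , a≤ , F  = climb N  hx′
          b , b≤ , F′ = climb N′ hy′
      in a + b , ≤-trans (+-mono-≤ (≤-trans a≤ m≤ρ) (≤-trans b≤ m′≤ρ)) (m≤m+n (ρ + ρ) _) ,
          F ++ᴾ reverseᴾ linked-sym F′
      where
      -- That `c` belongs to the piece follows from `N`, which joins it to `u` without leaving
      -- `Rem ℓ`.
      climb : ∀ {u m} → Path (Edge (mask (Rem ℓ) g)) c u m → u ∈ˢ A → ∃[ a ] (a ≤ m × Path Linked u c a)
      climb N hu with forest-path {X = inter A (singleton c)}
            (from ∈-inter (from ∈-component (_ , proj₂ (to ∈-component hu) ++ᴾ reverseᴾ mask-sym N) ,
                from ∈-singleton refl))
            (path-in-piece ℓ (proj₂ (to ∈-component hu) ++ᴾ reverseᴾ mask-sym N) N)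
      ... | z , a , hz , a≤m , F = a , a≤m , subst (λ z → Path Linked _ z a)
          (to ∈-singleton (proj₂ (to ∈-inter hz)))
        (mapᴾ (forest⇒linked ℓ ℓ<n (λ e → from ∈-parents (c , c∈C , inj₂ e)) p∈R) F)

    total : ∀ {x y i j} (h : Hop x i) (h′ : Hop y j) →
        (∃[ d ] (d ≤ ρ + ρ + ℓ * (ρ + ρ) × Path Linked (proj₁ h) (proj₁ h′) d)) →
            ∃[ d ] (d ≤ i + j + suc ℓ * (ρ + ρ) × Path Linked x y d)
    total {i = i} {j} (_ , a , a≤i , F , _) (_ , b , b≤j , F′ , _) (d , d≤ , D) =
      a + (d + b) ,
      (begin
        a + (d + b)   ≡⟨ cong (a +_) (+-comm d b) ⟩
        a + (b + d)   ≡⟨ +-assoc a b d ⟨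
        a + b + d     ≤⟨ +-mono-≤ (+-mono-≤ a≤i b≤j) d≤ ⟩
        i + j + suc ℓ * (ρ + ρ) ∎) ,
      F ++ᴾ (D ++ᴾ reverseᴾ linked-sym F′)
      where open ≤-Reasoning

    cross : ∀ {x y i j} → Path (Edge (mask (Rem ℓ) g)) p x i → Path (Edge (mask (Rem ℓ) g)) p y j →
            ∃[ d ] (d ≤ i + j + suc ℓ * (ρ + ρ) × Path Linked x y d)
    cross P Q = total (hop P) (hop Q) (across (hop P) (hop Q))

  -- If either part leaves `Rem ℓ`, a vertex outside takes over the role of `p` and the surplus
  -- `ℓ * (ρ + ρ)` suffices. Otherwise the walk lies in the piece of `p`, whose separator deletes
  -- `p` at this level.
  detour-suc : ∀ ℓ → ℓ < n → Detour ℓ → Detour (suc ℓ)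
  detour-suc ℓ ℓ<n ih {x} {p} {y} {i} {j} hp P Q with stays⊎leaves (Rem ℓ) P | stays⊎leaves (Rem ℓ) Q
  ... | inj₂ (q , a , b , hq , P₁ , P₂ , refl) | _ with ih hq P₁ (P₂ ++ᴾ Q)
  ...   | d , d≤ , D = d , ≤-trans d≤ (≤-trans (≤-reflexive
      (cong (_+ ℓ * (ρ + ρ)) (sym (+-assoc a b j)))) (+-monoʳ-≤ (a + b + j) (m≤n+m _ (ρ + ρ)))) , D
  detour-suc ℓ ℓ<n ih {x} {p} {y} {i} {j} hp P Q | inj₁ _ | inj₂ (q , a , b , hq , Q₁ , Q₂ , refl) with
      ih hq (P ++ᴾ Q₁) Q₂
  ...   | d , d≤ , D = d , ≤-trans d≤ (≤-trans (≤-reflexive (cong (_+ ℓ * (ρ + ρ)) (+-assoc i a b)))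
      (+-monoʳ-≤ (i + (a + b)) (m≤n+m _ (ρ + ρ)))) , D
  detour-suc ℓ ℓ<n ih {x} {p} {y} {i} {j} hp P Q | inj₁ (_ , P′) | inj₁ (p∈R , Q′)
    with p ∈ˢ? separator k (piece ℓ p) g
  ... | no ¬h = ⊥-elim (hp (from ∈-level (p∈R , ¬h)))
  ... | yes h with to ∈-cover h
  ...   | c , c∈C , p∈B = Crossing.cross ℓ ℓ<n ih p∈R c∈C p∈B (reverseᴾ mask-sym P′) Q′

  detour : ∀ ℓ → ℓ ≤ n → Detour ℓ
  detour zero    _ h _ _ = ⊥-elim (h ∈-full)
  detour (suc ℓ) l = detour-suc ℓ l (detour ℓ (<⇒≤ l))

-- The number of links

count-unique : ∀ {n} (f : Fin n → Bool) → (∀ {u v} → Holds (f u) → Holds (f v) → u ≡ v) → count f ≤ 1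
count-unique {zero}  f unique = z≤n
count-unique {suc n} f unique with f zero in eq
... | false = count-unique (f ∘ suc) λ h h′ → Fin.suc-injective (unique h h′)
... | true  = s≤s (≤-trans (sum-mono {n} {g = λ _ → 0} λ i → none i)
    (≤-reflexive (trans (sum-const n 0) (*-zeroʳ n))))
  where
  none : ∀ i → bit (f (suc i)) ≤ 0
  none i with f (suc i) in eq′
  ... | false = z≤n
  ... | true with unique {zero} {suc i} (subst Holds (sym eq) _) (subst Holds (sym eq′) _)
  ...   | ()

term≤sum : ∀ {n} (f : Fin n → ℕ) i → f i ≤ sum f
term≤sum f zero    = m≤m+n _ _
term≤sum f (suc i) = ≤-trans (term≤sum (f ∘ suc) i) (m≤n+m _ _)

sum-bit* : ∀ {n} b (f : Fin n → ℕ) → sum (λ w → bit b * f w) ≤ bit b * sum f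
sum-bit* {n} false f = ≤-reflexive (trans (sum-const n 0) (*-zeroʳ n))
sum-bit*     true  f = ≤-reflexive (trans (go f) (sym (+-identityʳ _)))
  where
  go : ∀ {n} (f : Fin n → ℕ) → sum (λ w → f w + 0) ≡ sum f
  go {zero}  f = refl
  go {suc n} f = cong₂ _+_ (+-identityʳ (f zero)) (go (f ∘ suc))

sum-*ʳ : ∀ {n} (f : Fin n → ℕ) c → sum (λ i → f i * c) ≡ sum f * c
sum-*ʳ {zero}  f c = refl
sum-*ʳ {suc n} f c = trans (cong (f zero * c +_) (sum-*ʳ (f ∘ suc) c))
    (sym (*-distribʳ-+ c (f zero) (sum (f ∘ suc))))

Holds⇒1≤bit : ∀ {b} → Holds b → 1 ≤ bit b
Holds⇒1≤bit {true} _ = ≤-refl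

bit≤ : ∀ b {m} → (Holds b → 1 ≤ m) → bit b ≤ m
bit≤ false p = z≤n
bit≤ true  p = p _

-- Double counting: every parent of `u` comes from one of the two forests of some centre, and by
-- `forest-unique` each forest supplies at most one. `weight c w` is the number of forests of `c` in
-- which `w` is the parent of `u`.
size-parents : ∀ {n} (A : Val n set) s K u → size (parents A s K u) ≤ size (proj₁ s) * 2
size-parents {n} A s K u = begin
  sum (λ w → bit (lookup (parents A s K u) w))
      ≤⟨ sum-mono (λ w → bit≤ (lookup (parents A s K u) w) (bound w)) ⟩
  sum (λ w → sum (λ c → bit (lookup C c) * weight c w))
      ≡⟨ ∑-comm (λ w c → bit (lookup C c) * weight c w) ⟩
  sum (λ c → sum (λ w → bit (lookup C c) * weight c w))
      ≤⟨ sum-mono (λ c → ≤-trans (sum-bit* (lookup C c) (weight c))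
          (*-monoʳ-≤ (bit (lookup C c)) (two c))) ⟩
  sum (λ c → bit (lookup C c) * 2)                        ≡⟨ sum-*ʳ (bit ∘ lookup C) 2 ⟩
  size C * 2                                              ∎
  where
  open ≤-Reasoning
  C : Val n set
  C = proj₁ s
  F₁ F₂ : Fin n → Val n mat
  F₁ c = forest (inter A (lookup (proj₂ s) c)) K
  F₂ c = forest (inter A (singleton c)) K
  weight : Fin n → Fin n → ℕ
  weight c w = bit (lookup (lookup (F₁ c) u) w) + bit (lookup (lookup (F₂ c) u) w)
  two : ∀ c → sum (weight c) ≤ 2
  two c = ≤-trans (≤-reflexive (∑-distrib-+ (bit ∘ lookup (lookup (F₁ c) u))
      (bit ∘ lookup (lookup (F₂ c) u))))
    (+-mono-≤ (count-unique (lookup (lookup (F₁ c) u)) λ h h′ →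
        forest-unique {X = inter A (lookup (proj₂ s) c)} (edge (mem h)) (edge (mem h′)))
              (count-unique (lookup (lookup (F₂ c) u)) λ h h′ →
                  forest-unique {X = inter A (singleton c)} (edge (mem h)) (edge (mem h′))))
  bound : ∀ w → Holds (lookup (parents A s K u) w) → 1 ≤ sum (λ c → bit (lookup C c) * weight c w)
  bound w h with to ∈-parents (mem h)
  ... | c , c∈C , e = ≤-trans (*-mono-≤ (Holds⇒1≤bit (member c∈C))
    ([ (λ e → ≤-trans (Holds⇒1≤bit (member (target e))) (m≤m+n _ _))
     , (λ e → ≤-trans (Holds⇒1≤bit (member (target e))) (m≤n+m _ (bit (lookup (lookup (F₁ c) u) w)))) ]′ e))
    (term≤sum (λ c → bit (lookup C c) * weight c w) c)

size-insert : ∀ {n} (C : Val n set) v → size (insert C v) ≤ size C + 1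
size-insert {n} C v = begin
  sum (bit ∘ lookup (insert C v))
      ≤⟨ sum-mono (λ u → bit≤ (lookup (insert C v) u) (bound u)) ⟩
  sum (λ u → bit (lookup C u) + bit (lookup (singleton v) u))
      ≡⟨ ∑-distrib-+ (bit ∘ lookup C) (bit ∘ lookup (singleton v)) ⟩
  size C + size (singleton v)
      ≤⟨ +-monoʳ-≤ (size C) (count-unique (lookup (singleton v)) λ h h′ →
                                                                      trans (to ∈-singleton (mem h))
                                                                          (sym (to ∈-singleton (mem h′)))) ⟩
  size C + 1                                                     ∎
  where
  open ≤-Reasoning
  bound : ∀ u → Holds (lookup (insert C v) u) → 1 ≤ bit (lookup C u) + bit (lookup (singleton v) u)
  bound u h with to ∈-insert (mem h)
  ... | inj₁ h′ = ≤-trans (Holds⇒1≤bit (member h′)) (m≤m+n _ _)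
  ... | inj₂ eq = ≤-trans (Holds⇒1≤bit (member (from (∈-singleton {v = v}) eq)))
      (m≤n+m _ (bit (lookup C u)))

size-insertAll : ∀ {n k} (C : Val n set) (vs : Vec (Fin n) k) → size (insertAll C vs) ≤ size C + k
size-insertAll C [] = ≤-reflexive (sym (+-identityʳ (size C)))
size-insertAll {k = suc k} C (v ∷ vs) = begin
  size (insertAll (insert C v) vs)   ≤⟨ size-insertAll (insert C v) vs ⟩
  size (insert C v) + k              ≤⟨ +-monoˡ-≤ k (size-insert C v) ⟩
  size C + 1 + k                     ≡⟨ +-assoc (size C) 1 k ⟩
  size C + suc k                     ∎
  where open ≤-Reasoning

size-empty : ∀ {n} → size (empty {n}) ≡ 0
size-empty {n} = n≤0⇒n≡0 (≤-trans (sum-mono {n} {g = λ _ → 0}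
    (λ u → bit≤ (lookup (empty {n}) u) λ h → ⊥-elim (∉-empty (mem h))))
                                  (≤-reflexive (trans (sum-const n 0) (*-zeroʳ n))))

-- From links to undirected edges

edges : ∀ {n} → Val n mat → ℕ
edges N = sum λ u → size (lookup N u)

edges-symmetric : ∀ {n} (N : Val n mat) →
  sum (λ u → sum λ v → bit (lookup (lookup N u) v) + bit (lookup (lookup N v) u)) ≡ edges N + edges N
edges-symmetric N = begin
  sum (λ u → sum λ v → bit (lookup (lookup N u) v) + bit (lookup (lookup N v) u))
    ≡⟨ sum-cong-≗ (λ u → ∑-distrib-+ (bit ∘ lookup (lookup N u)) (λ v → bit (lookup (lookup N v) u))) ⟩
  sum (λ u → size (lookup N u) + sum λ v → bit (lookup (lookup N v) u))
    ≡⟨ ∑-distrib-+ (λ u → size (lookup N u)) (λ u → sum λ v → bit (lookup (lookup N v) u)) ⟩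
  edges N + sum (λ u → sum λ v → bit (lookup (lookup N v) u))
    ≡⟨ cong (edges N +_) (∑-comm (λ u v → bit (lookup (lookup N v) u))) ⟩
  edges N + edges N ∎
  where open ≡-Reasoning

module _ {n} {P : Fin n × Fin n → Set} (P? : U.Decidable P) (w : Fin n → Fin n → ℕ)
    (P⇒w : ∀ u v → P (u , v) → 1 ≤ w u v) where
  length-filter-row : ∀ {m} u (h : Fin m → Fin n) →
      List.length (List.filter P? (List.map (u ,_) (List.tabulate h))) ≤ sum (w u ∘ h)
  length-filter-row {zero}  u h = z≤n
  length-filter-row {suc m} u h with P? (u , h zero)
  ... | yes p = +-mono-≤ (P⇒w u (h zero) p) (length-filter-row u (h ∘ suc))
  ... | no  _ = ≤-trans (length-filter-row u (h ∘ suc)) (m≤n+m _ (w u (h zero)))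

  length-filter-grid : ∀ {m} (f : Fin m → Fin n) →
    List.length (List.filter P? (List.cartesianProduct (List.tabulate f) (List.allFin n))) ≤ sum
        (λ i → sum (w (f i)))
  length-filter-grid {zero}  f = z≤n
  length-filter-grid {suc m} f = begin
    List.length (List.filter P? (row List.++ rows))
        ≡⟨ cong List.length (List.filter-++ P? row rows) ⟩
    List.length (List.filter P? row List.++ List.filter P? rows)
        ≡⟨ List.length-++ (List.filter P? row) ⟩
    List.length (List.filter P? row) + List.length (List.filter P? rows)
        ≤⟨ +-mono-≤ (length-filter-row (f zero) id) (length-filter-grid (f ∘ suc)) ⟩
    sum (w (f zero)) + sum (λ i → sum (w (f (suc i))))                       ∎
    where
    open ≤-Reasoning
    row rows : List (Fin n × Fin n)
    row  = List.map (f zero ,_) (List.allFin n)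
    rows = List.cartesianProduct (List.tabulate (f ∘ suc)) (List.allFin n)

-- The order condition of `edgeCount` is dropped: all ordered pairs are counted with the links in
-- both directions, which counts each link twice.
edgeCount-bound : ∀ {n} (H : Graph n) (N : Val n mat) → (∀ {u v} → Adj H u v → Edge N u v ⊎ Edge N v u) →
                  edgeCount H ≤ edges N + edges N
edgeCount-bound H N cover = ≤-trans
  (length-filter-grid _ (λ u v → bit (lookup (lookup N u) v) + bit (lookup (lookup N v) u))
      (λ u v (_ , e) → bound (cover e)) id)
  (≤-reflexive (edges-symmetric N))
  where
  bound : ∀ {u v} → Edge N u v ⊎ Edge N v u → 1 ≤ bit (lookup (lookup N u) v) + bit (lookup (lookup N v) u)
  bound (inj₁ e) = ≤-trans (Holds⇒1≤bit (member (target e))) (m≤m+n _ _)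
  bound {u} {v} (inj₂ e) = ≤-trans (Holds⇒1≤bit (member (target e))) (m≤n+m _ (bit (lookup (lookup N u) v)))

module LevelCount {n} (G : Graph n) (k ρ : ℕ)
  (good : ∀ A → ∃[ r ] (r ≤ ρ × Separates k A (adjacency G) r (sep k A (adjacency G)))) where
  open Recursion G k ρ good

  row-bound : ∀ ℓ u → size (lookup (Link (suc ℓ)) u) ≤ size (lookup (Link ℓ) u) + k * 2
  row-bound ℓ u = begin
    sum (bit ∘ lookup (lookup (Link (suc ℓ)) u))
        ≤⟨ sum-mono (λ w → bit≤ (lookup (lookup (Link (suc ℓ)) u) w) (bound w)) ⟩
    sum (λ w → bit (lookup (lookup (Link ℓ) u) w) + bit (lookup (new) w))
        ≡⟨ ∑-distrib-+ (bit ∘ lookup (lookup (Link ℓ) u)) (bit ∘ lookup new) ⟩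
    size (lookup (Link ℓ) u) + size new
        ≤⟨ +-monoʳ-≤ (size (lookup (Link ℓ) u)) (≤-trans
            (size-parents (piece ℓ u) (sep k (piece ℓ u) g) (mask (piece ℓ u) g) u) (*-monoˡ-≤ 2 centres)) ⟩
    size (lookup (Link ℓ) u) + k * 2               ∎
    where
    open ≤-Reasoning
    new : Val n set
    new = links k (piece ℓ u) g u
    centres : size (proj₁ (sep k (piece ℓ u) g)) ≤ k
    centres with good (piece ℓ u)
    ... | _ , _ , vs , eq , _ = subst (λ s → size (proj₁ s) ≤ k) (sym eq)
      (≤-trans (size-insertAll empty vs) (≤-reflexive (cong (_+ k) (size-empty {n}))))
    bound : ∀ w → Holds (lookup (lookup (Link (suc ℓ)) u) w) →
        1 ≤ bit (lookup (lookup (Link ℓ) u) w) + bit (lookup new w)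
    bound w h with to Edge-level (edge (mem h))
    ... | inj₁ e       = ≤-trans (Holds⇒1≤bit (member (target e))) (m≤m+n _ _)
    ... | inj₂ (_ , e) = ≤-trans (Holds⇒1≤bit (member e)) (m≤n+m _ (bit (lookup (lookup (Link ℓ) u) w)))

  row-unchanged : ∀ ℓ u → ¬ u ∈ˢ Rem ℓ → size (lookup (Link (suc ℓ)) u) ≤ size (lookup (Link ℓ) u)
  row-unchanged ℓ u ¬h = size-mono {X = lookup (Link (suc ℓ)) u} {lookup (Link ℓ) u} λ h →
    [ target , (λ (h , _) → ⊥-elim (¬h h)) ]′ (to Edge-level (edge h))

  -- A level adds at most 2k links per vertex, and none once 2^ℓ exceeds n.
  edges-bound : ∀ {L} → n < 2 ^ L → ∀ ℓ → edges (Link ℓ) ≤ L * (n * (k * 2))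
  edges-bound {L} n<2^L ℓ = ≤-trans (go ℓ) (*-monoˡ-≤ _ (m⊓n≤n ℓ L))
    where
    open ≤-Reasoning
    go : ∀ ℓ → edges (Link ℓ) ≤ (ℓ ⊓ L) * (n * (k * 2))
    go zero = ≤-trans (sum-mono {n} {g = λ _ → 0} λ u →
        ≤-trans (≤-reflexive (cong (size {n}) (lookup∘tabulate (λ _ → empty) u)))
            (≤-reflexive (size-empty {n})))
                      (≤-reflexive (trans (sum-const n 0) (*-zeroʳ n)))
    go (suc ℓ) with ℓ <? L
    ... | yes ℓ<L = begin
      edges (Link (suc ℓ))                                            ≤⟨ sum-mono (row-bound ℓ) ⟩
      sum (λ u → size (lookup (Link ℓ) u) + k * 2)
          ≡⟨ ∑-distrib-+ (λ u → size (lookup (Link ℓ) u)) (λ _ → k * 2) ⟩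
      edges (Link ℓ) + sum {n} (λ _ → k * 2)
          ≡⟨ cong (edges (Link ℓ) +_) (sum-const n (k * 2)) ⟩
      edges (Link ℓ) + n * (k * 2)                                    ≤⟨ +-monoˡ-≤ _ (go ℓ) ⟩
      (ℓ ⊓ L) * (n * (k * 2)) + n * (k * 2)
          ≡⟨ cong (λ z → z * (n * (k * 2)) + n * (k * 2)) (m≤n⇒m⊓n≡m (<⇒≤ ℓ<L)) ⟩
      ℓ * (n * (k * 2)) + n * (k * 2)                                 ≡⟨ +-comm (ℓ * (n * (k * 2))) _ ⟩
      suc ℓ * (n * (k * 2))
          ≡⟨ cong (_* (n * (k * 2))) (m≤n⇒m⊓n≡m ℓ<L) ⟨
      (suc ℓ ⊓ L) * (n * (k * 2))                                     ∎
    ... | no ℓ≮L = begin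
      edges (Link (suc ℓ))       ≤⟨ sum-mono (λ u →
          row-unchanged ℓ u (Rem-empty ℓ (<-≤-trans n<2^L (^-monoʳ-≤ 2 (≮⇒≥ ℓ≮L))))) ⟩
      edges (Link ℓ)             ≤⟨ go ℓ ⟩
      (ℓ ⊓ L) * (n * (k * 2))    ≤⟨ *-monoˡ-≤ _ (⊓-monoˡ-≤ L (n≤1+n ℓ)) ⟩
      (suc ℓ ⊓ L) * (n * (k * 2)) ∎

-- The theorem

walk⇒path : ∀ {n} {G : Graph n} {u v ℓ} → Walk G u v ℓ → Path (Adj G) u v ℓ
walk⇒path []      = []
walk⇒path (e ∷ p) = e ∷ walk⇒path p

path⇒walk : ∀ {n} {G : Graph n} {u v ℓ} → Path (Adj G) u v ℓ → Walk G u v ℓ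
path⇒walk []      = []
path⇒walk (e ∷ p) = e ∷ path⇒walk p

adj⇒distance : ∀ {n} (G : Graph n) {u v} → Adj G u v → IsDistance G u v 1
adj⇒distance G e = e ∷ [] , λ { zero [] → ⊥-elim (Graph.irrefl G e) ; (suc _) _ → s≤s z≤n }

path⇒distance : ∀ {n} (G : Graph n) {u v ℓ} → Path (Adj G) u v ℓ → ∃[ d ] (IsDistance G u v d × d ≤ ℓ)
path⇒distance G {ℓ = ℓ} p with shortest (λ u v → T? (adj G u v)) p
... | d , q , min = d , (path⇒walk q , λ m w → min m (walk⇒path w)) , min ℓ p

-- The search chooses exactly `k` centres, so a smaller bag is padded with `v₀`. Extra centres are
-- harmless, as `BalancedBag` only asks that the centres include the bag.
listing : ∀ {m n} (p : Subset m) (f : Fin m → Fin n) k → Fin n → ∣ p ∣ ≤ k →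
          ∃[ vs ] (∀ {v} → v ∈ᵇ p → ∃[ j ] lookup {n = k} vs j ≡ f v)
listing []          f k       v₀ l       = replicate k v₀ , λ ()
listing (false ∷ p) f k       v₀ l       with listing p (f ∘ suc) k v₀ l
... | vs , all = vs , λ { (there h) → all h }
listing (true ∷ p)  f (suc k) v₀ (s≤s l) with listing p (f ∘ suc) k v₀ l
... | vs , all = f zero ∷ vs , λ { here → zero , refl ; (there h) → let j , eq = all h in suc j , eq }

insertAll-mono : ∀ {n k} {C : Val n set} (vs : Vec (Fin n) k) → C ⊆ˢ insertAll C vs
insertAll-mono []       h = h
insertAll-mono (v ∷ vs) h = insertAll-mono vs (from ∈-insert (inj₁ h))

lookup∈insertAll : ∀ {n k} {C : Val n set} (vs : Vec (Fin n) k) j → lookup vs j ∈ˢ insertAll C vs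
lookup∈insertAll (v ∷ vs) zero    = insertAll-mono vs (from ∈-insert (inj₂ refl))
lookup∈insertAll (v ∷ vs) (suc j) = lookup∈insertAll vs j

bag-size : ∀ {n} {S : Graph n} (D : TreeDecomposition S) {k} → 1 ≤ k → width D ≡ k ∸ 1 → ∀ i →
    ∣ TreeDecomposition.bag D i ∣ ≤ k
bag-size D {suc k} _ eq i = begin
  ∣ bag i ∣                            ≤⟨ All.tabulate⁻ (xs≤max 0 sizes) i ⟩
  -- The truncated subtraction in `width` makes this an inequality.
  max 0 sizes                          ≤⟨ m≤n+m∸n (max 0 sizes) 1 ⟩
  suc (max 0 sizes ∸ 1)                ≡⟨ cong suc eq ⟩
  suc k                                ∎
  where
  open ≤-Reasoning
  open TreeDecomposition D using (bag)
  sizes : List ℕ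
  sizes = List.tabulate λ i → ∣ bag i ∣

-- Here the spanner `S` and its decomposition do their work: some bag shows that `k` balls of radius
-- `⌈ t /2⌉` suffice for `A`, so the search, which knows neither `S` nor `t`, stops no later than at
-- this radius.
separates : ∀ {n} (G S : Graph n) {t k} → 1 ≤ k → Fin n → IsSpanner t S G → HasTreeWidth S (k ∸ 1) →
            ∀ A → ∃[ r ] (r ≤ ⌈ t /2⌉ × Separates k A (adjacency G) r (sep k A (adjacency G)))
separates {n} G S {t} {k} 1≤k v₀ spanning tw A = sep-separates k A (adjacency G)
    {vs = proj₁ (bagList (proj₁ balanced))} (proj₂ balanced)
  where
  D : TreeDecomposition S
  D = HasTreeWidth.decomposition tw

  bagList : ∀ i → ∃[ vs ] (∀ {v} → v ∈ᵇ TreeDecomposition.bag D i → ∃[ j ] lookup {n = k} vs j ≡ v)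
  bagList i = listing (TreeDecomposition.bag D i) id k v₀ (bag-size D 1≤k (HasTreeWidth.attained tw) i)

  centres : Fin (TreeDecomposition.size D) → Val n set
  centres i = insertAll empty (proj₁ (bagList i))

  bag⊆centres : ∀ {i v} → v ∈ᵇ TreeDecomposition.bag D i → v ∈ˢ centres i
  bag⊆centres {i} h with proj₂ (bagList i) h
  ... | j , eq = subst (_∈ˢ centres i) eq (lookup∈insertAll (proj₁ (bagList i)) j)

  spans : ∀ {u v} → Adj G u v → ∃[ ℓ ] (ℓ ≤ t × Path (Adj S) u v ℓ)
  spans e with IsSpanner.stretch spanning _ _ 1 (adj⇒distance G e)
  ... | d , (w , _) , d≤ = d , subst (d ≤_) (*-identityʳ t) d≤ , walk⇒path w

  t≤2ρ : t ≤ ⌈ t /2⌉ + ⌈ t /2⌉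
  t≤2ρ = ≤-trans (≤-reflexive (sym (⌊n/2⌋+⌈n/2⌉≡n t))) (+-monoˡ-≤ ⌈ t /2⌉ (⌊n/2⌋≤⌈n/2⌉ t))

  balanced : ∃[ i ] Balanced A (adjacency G) (balls (adjacency G) ⌈ t /2⌉) (centres i)
  balanced = BalancedBag.bag-balanced {G = G} (IsSpanner.subgraph spanning) D {ρ = ⌈ t /2⌉} t≤2ρ spans
      centres bag⊆centres A v₀

n<2^n : ∀ n → n < 2 ^ n
n<2^n zero    = s≤s z≤n
n<2^n (suc n) = begin-strict
  suc n                ≤⟨ n<2^n n ⟩
  2 ^ n                <⟨ m<n+m (2 ^ n) (≤-trans (s≤s z≤n) (n<2^n n)) ⟩
  2 ^ n + 2 ^ n        ≡⟨ cong (2 ^ n +_) (+-identityʳ (2 ^ n)) ⟨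
  2 ^ suc n            ∎
  where open ≤-Reasoning

log : ∀ n → 1 ≤ n → ∃[ m ] (2 ^ m ≤ n × n < 2 ^ suc m)
log n 1≤n with least (λ m → n < 2 ^ m) (λ m → n <? 2 ^ m) n (n<2^n n)
... | zero  , n<1 , _   = ⊥-elim (<⇒≱ n<1 1≤n)
... | suc m , n<  , min = m , ≮⇒≥ (λ n<2^m → 1+n≰n (min m n<2^m)) , n<

module Result {n} (G : Graph n) (1≤n : 1 ≤ n) (k ρ : ℕ)
  (good : ∀ A → ∃[ r ] (r ≤ ρ × Separates k A (adjacency G) r (sep k A (adjacency G)))) where
  open Recursion G k ρ good
  open LevelCount G k ρ good

  linked⇔ : ∀ {u v} → Linked u v ⇔ T (lookup (lookup (spanner k g) u) v)
  linked⇔ = mk⇔ (true! ∘ member ∘ target) (edge ∘ mem ∘ holds)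

  H : Graph n
  H = record
    { adj    = λ u v → lookup (lookup (spanner k g) u) v
    ; sym    = λ e → to linked⇔ (linked-sym (from linked⇔ e))
    ; irrefl = λ e → Graph.irrefl G (linked⇒adj (from linked⇔ e))
    }

  m = proj₁ (log n 1≤n)
  2^m≤n = proj₁ (proj₂ (log n 1≤n))
  n<2^1+m = proj₂ (proj₂ (log n 1≤n))

  additive : IsAdditiveSpanner ((2 * ρ) + (2 * ρ) ·log₂ n) H G
  additive = record
    { subgraph = λ u v e → linked⇒adj (from linked⇔ e)
    ; stretch  = stretch
    }
    where
    stretch : ∀ u v d → IsDistance G u v d → ∃[ d′ ]
        (IsDistance H u v d′ × d′ ≤ d ⊕ ((2 * ρ) + (2 * ρ) ·log₂ n))
    -- Nothing remains at level `suc m`, so `u` itself serves as the deleted vertex. Of the surplus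
    -- `suc m * (ρ + ρ)`, one summand is the constant term, and `2 ^ m ≤ n` bounds the rest by the
    -- logarithmic term.
    stretch u v d (w , _) with detour (suc m) (≤-trans (n<2^n m) 2^m≤n) (Rem-empty (suc m) {u} n<2^1+m)
        [] (walk⇒path w)
    ... | i , i≤ , P with path⇒distance H (mapᴾ (to linked⇔) P)
    ...   | d′ , dist , d′≤i = d′ , dist , (begin
      2 ^ d′                               ≤⟨ ^-monoʳ-≤ 2 (≤-trans d′≤i i≤) ⟩
      2 ^ (d + suc m * (ρ + ρ))            ≡⟨ cong (2 ^_)
          (solve 3 (λ d m ρ → d :+ (con 1 :+ m) :* (ρ :+ ρ) := (d :+ con 2 :* ρ) :+ m :* (con 2 :* ρ))
              refl d m ρ) ⟩
      2 ^ (d + 2 * ρ + m * (2 * ρ))        ≡⟨ ^-distribˡ-+-* 2 (d + 2 * ρ) (m * (2 * ρ)) ⟩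
      2 ^ (d + 2 * ρ) * 2 ^ (m * (2 * ρ))  ≡⟨ cong (2 ^ (d + 2 * ρ) *_) (^-*-assoc 2 m (2 * ρ)) ⟨
      2 ^ (d + 2 * ρ) * (2 ^ m) ^ (2 * ρ)  ≤⟨ *-monoʳ-≤ (2 ^ (d + 2 * ρ)) (^-monoˡ-≤ (2 * ρ) 2^m≤n) ⟩
      2 ^ (d + 2 * ρ) * n ^ (2 * ρ)        ∎)
      where
      open ≤-Reasoning
      open +-*-Solver

  -- The constant 8 is the product of three factors 2: two forests per centre, `1 + m ≤ 2 * m` for
  -- the number of levels, and the doubling in `edgeCount-bound`.
  sparse : 2 ≤ n → edgeCount H ≤ 0 ⊕ (0 + (8 * k * n) ·log₂ n)
  sparse 2≤n = begin
    2 ^ edgeCount H          ≤⟨ ^-monoʳ-≤ 2 edges≤ ⟩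
    2 ^ (m * (8 * k * n))    ≡⟨ ^-*-assoc 2 m (8 * k * n) ⟨
    (2 ^ m) ^ (8 * k * n)    ≤⟨ ^-monoˡ-≤ (8 * k * n) 2^m≤n ⟩
    n ^ (8 * k * n)          ≡⟨ +-identityʳ _ ⟨
    1 * n ^ (8 * k * n)      ∎
    where
    open ≤-Reasoning
    open +-*-Solver
    1≤m : ∀ m → n < 2 ^ suc m → 1 ≤ m
    1≤m zero    l = ⊥-elim (<⇒≱ l 2≤n)
    1≤m (suc m) l = s≤s z≤n
    L≤ : edges (Link n) ≤ 2 * m * (n * (k * 2))
    L≤ = ≤-trans (edges-bound {suc m} n<2^1+m n) (*-monoˡ-≤ (n * (k * 2))
      (≤-trans (+-monoˡ-≤ m (1≤m m n<2^1+m)) (≤-reflexive (cong (m +_) (sym (+-identityʳ m))))))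
    edges≤ : edgeCount H ≤ m * (8 * k * n)
    edges≤ = begin
      edgeCount H
          ≤⟨ edgeCount-bound H (Link n) (λ e → to Edge-spanner (from linked⇔ e)) ⟩
      edges (Link n) + edges (Link n)                     ≤⟨ +-mono-≤ L≤ L≤ ⟩
      2 * m * (n * (k * 2)) + 2 * m * (n * (k * 2))
          ≡⟨ solve 3 (λ m k n → con 2 :* m :* (n :* (k :* con 2)) :+ con 2 :* m :* (n :* (k :* con 2))
              := m :* (con 8 :* k :* n)) refl m k n ⟩
      m * (8 * k * n)                                     ∎

sparse : ∀ {n} (G : Graph n) (1≤n : 1 ≤ n) k ρ good →
         edgeCount (Result.H G 1≤n k ρ good) ≤ 0 ⊕ (0 + (8 * k * n) ·log₂ n)
-- On one vertex `m` is 0 and `1 + m ≤ 2 * m` fails, but `edgeCount` computes to 0.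
sparse {suc zero}    G 1≤n k ρ good = ≤-trans (m^n>0 1 (8 * k * 1)) (m≤m+n _ 0)
sparse {suc (suc n)} G 1≤n k ρ good = Result.sparse G 1≤n k ρ good (s≤s (s≤s z≤n))

theorem8 : Σ[ C ∈ ℕ ]
    ((k : ℕ) → 1 ≤ k →
    Σ[ p ∈ Program ] Σ[ a ∈ ℕ ] Σ[ e ∈ ℕ ]
    ((t : ℕ) → 1 ≤ t →
    (n : ℕ) (G : Graph n) → Connected G →
    (Σ[ S ∈ Graph n ] (IsSpanner t S G × HasTreeWidth S (k ∸ 1))) →
    Σ[ H ∈ Graph n ]
    ( IsAdditiveSpanner ((2 * ⌈ t /2⌉) + (2 * ⌈ t /2⌉) ·log₂ n) H G
    × edgeCount H ≤ 0 ⊕ (0 + (C * k * n) ·log₂ n)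
    × Σ[ c ∈ ℕ ] (p ⊢ encode G ⇓ encode H [ c ] × c ≤ a * n ^ e))))
-- The program is fixed by `k` before `t` and `G` are given. The final `refl` works because `H` is
-- defined by lookup in the very matrix that the program computes.
theorem8 = 8 , λ k 1≤k → let p , a , e , correct = realize (spannerT k) in p , a , e ,
  λ { t 1≤t zero G conn → ⊥-elim (Graph0 conn)
    ; t 1≤t (suc n) G conn (S , spanning , tw) →
      let good = separates G S 1≤k zero spanning tw
          H    = Result.H G (s≤s z≤n) k ⌈ t /2⌉ good
      in H , Result.additive G (s≤s z≤n) k ⌈ t /2⌉ good , sparse G (s≤s z≤n) k ⌈ t /2⌉ good ,
         correct (s≤s z≤n) G H (λ u v → refl) }
  where
  Graph0 : {G : Graph 0} → Connected G → ⊥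
  Graph0 record { nonEmpty = () }
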